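{- For any integer $n\ge0$, $$\widetilde{Q}_n(\mathbf{x},t)=\sum_{\sigma\in\widetilde{\mathfrak{S}}_n}F_{\mathrm{DEX}(\sigma),n}(\mathbf{x})\,t^{\mathrm{exc}(\sigma)+1}.$$ Equivalently, for all $0\le j\le n$, $$\widetilde{Q}_{n,j}(\mathbf{x})=\sum_{\substack{\sigma\in\widetilde{\mathfrak{S}}_n\\ \mathrm{exc}(\sigma)=j-1}}F_{\mathrm{DEX}(\sigma),n}(\mathbf{x}).$$
   Context: Fundamental quasisymmetric functions: for $n\ge1$ and $S\subseteq[n-1]$, $F_{S,n}(\mathbf{x})=\sum x_{i_1}x_{i_2}\cdots x_{i_n}$, summed over $i_1\ge i_2\ge\cdots\ge i_n\ge1$ such that $j\in S\Rightarrow i_j>i_{j+1}$; $F_{\emptyset,0}=1$. $h_n(\mathbf x)$ is the complete homogeneous symmetric function ($h_0=1$). $\mathrm{DES}(w)=\{i\in[n-1]:w_i>w_{i+1}\}$ for a word $w=w_1\cdots w_n$ over a totally ordered alphabet. For $\sigma\in\mathfrak{S}_k$ let $\mathrm{EXC}(\sigma)=\{i:\sigma_i>i\}$, $\mathrm{exc}(\sigma)=|\mathrm{EXC}(\sigma)|$, let $\overline\sigma$ be obtained from the word $\sigma$ by replacing $\sigma_i$ with $\overline{\sigma_i}$ for $i\in\mathrm{EXC}(\sigma)$, and let $\mathrm{DEX}(\sigma)=\mathrm{DES}(\overline\sigma)$ with respect to the order $\overline1<\cdots<\overline k<1<\cdots<k$. The Eulerian quasisymmetric functions are given by $Q_k(\mathbf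 x,t)=\sum_{\sigma\in\mathfrak{S}_k}F_{\mathrm{DEX}(\sigma),k}(\mathbf x)t^{\mathrm{exc}(\sigma)}$ for $k\ge1$. Define $$\widetilde Q_n(\mathbf x,t)=h_n(\mathbf x)+t\sum_{k=1}^nh_{n-k}(\mathbf x)Q_k(\mathbf x,t),$$ and let $\widetilde Q_{n,j}(\mathbf x)$ be the coefficient of $t^j$ in $\widetilde Q_n(\mathbf x,t)$. A decorated permutation of $[n]$ is a permutation of a subset $S\subseteq[n]$; its one-line notation is the word $\sigma=\sigma_1\cdots\sigma_n$ with $\sigma_i$ the image of $i$ if $i\in S$ and $\sigma_i=0$ if $i\notin S$. $\widetilde{\mathfrak S}_n$ is the set of decorated permutations of $[n]$ and $\theta=0\cdots0$. For $\sigma\ne\theta$: $\mathrm{EXC}(\sigma)=\{i\in[n]:i<\sigma_i\}$, $\mathrm{exc}(\sigma)=|\mathrm{EXC}(\sigma)|$, $\overline\sigma$ is obtained from $\sigma$ by replacing $\sigma_i$ by $\overline{\sigma_i}$ for $i\in\mathrm{EXC}(\sigma)$, and $\mathrm{DEX}(\sigma)=\mathrm{DES}(\overline\sigma)$ with respect to the order $\overline1<\cdots<\overline n<0<1<\cdots<n$. Also $\mathrm{exc}(\theta)=-1$ and $\mathrm{DEX}(\theta)=\emptyset$. -}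

module Defs where

open import Data.Bool.Base using (if_then_else_)
open import Data.Fin.Base as Fin using (Fin; zero; suc; toℕ; inject₁)
open import Data.Fin.Properties as Fin using (all?; any?)
open import Data.Fin.Subset using (Subset; _∈_; ⊥; ∣_∣)
open import Data.Fin.Subset.Properties using (_∈?_)
open import Data.Integer.Base as ℤ using (ℤ; +_; 0ℤ; 1ℤ; -1ℤ)
open import Data.List.Base as List using (List; []; _∷_; allFin; cartesianProductWith; filter; length; upTo)
open import Data.Nat.Base as ℕ using (ℕ; zero; suc; pred; _∸_)
open import Data.Nat.Properties as ℕ using ()
open import Data.Product.Base using (_×_; _,_; ∃-syntax; uncurry)
open import Data.Sum.Base using (_⊎_; inj₁; inj₂)
open import Data.Sum.Relation.Binary.LeftOrder using (_⊎-<_; ⊎-<-decidable)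
open import Data.Vec.Base as Vec using (Vec; []; _∷_; lookup; tabulate; replicate; count)
open import Data.Vec.Properties as Vec using ()
open import Data.Vec.Relation.Unary.AllPairs using (allPairs?)
open import Data.Vec.Relation.Unary.Unique.Propositional using (Unique)
open import Level using (0ℓ)
open import Relation.Binary.Core using (Rel)
open import Relation.Binary.Definitions using (Decidable)
open import Relation.Binary.PropositionalEquality.Core using (_≡_; _≢_)
open import Relation.Nullary.Decidable using (Dec; does; ¬?; _×-dec_; _→-dec_)

-- Formal power series over ℤ in x₁, x₂, …, given by their coefficients: for
-- e : Vec ℕ m, the value f m e is the coefficient in f of the monomial
-- x₁^e₁ ⋯ xₘ^eₘ.  A monomial is thus named once for every m bounding the
-- indices of its variables, and _≈ˢ_ compares all coefficients.

Series : Set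
Series = (m : ℕ) → Vec ℕ m → ℤ

infix 4 _≈ˢ_ _≈ᵗ_
infixl 6 _+ˢ_ _+ᵗ_
infixl 7 _*ˢ_ _·ᵗ_ _t^_

_≈ˢ_ : Series → Series → Set
f ≈ˢ g = ∀ m (e : Vec ℕ m) → f m e ≡ g m e

0ˢ 1ˢ : Series
0ˢ m e = 0ℤ
1ˢ m e = if does (Vec.≡-dec ℕ._≟_ e (replicate m 0)) then 1ℤ else 0ℤ

_+ˢ_ : Series → Series → Series
(f +ˢ g) m e = f m e ℤ.+ g m e

-- All pairs (a , b) of exponent vectors with a + b equal to the given one.
splits : ∀ {m} → Vec ℕ m → List (Vec ℕ m × Vec ℕ m)
splits []      = ([] , []) ∷ []
splits (k ∷ e) =
  cartesianProductWith (λ { i (a , b) → i ∷ a , (k ∸ i) ∷ b }) (upTo (suc k)) (splits e)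

sumℤ : List ℤ → ℤ
sumℤ = List.foldr ℤ._+_ 0ℤ

_*ˢ_ : Series → Series → Series
(f *ˢ g) m e = sumℤ (List.map (λ { (a , b) → f m a ℤ.* g m b }) (splits e))

∑ˢ : ∀ {A : Set} → List A → (A → Series) → Series
∑ˢ xs f = List.foldr _+ˢ_ 0ˢ (List.map f xs)

-- Polynomials in t over Series: P j is the coefficient of t^j.

Poly : Set
Poly = ℕ → Series

_≈ᵗ_ : Poly → Poly → Set
P ≈ᵗ R = ∀ j → P j ≈ˢ R j

0ᵗ : Poly
0ᵗ j = 0ˢ

_+ᵗ_ : Poly → Poly → Poly
(P +ᵗ R) j = P j +ˢ R j

_·ᵗ_ : Series → Poly → Poly
(f ·ᵗ P) j = f *ˢ P j

t·_ : Poly → Poly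
(t· P) zero    = 0ˢ
(t· P) (suc j) = P j

_t^_ : Series → ℕ → Poly
(f t^ k) j = if does (j ℕ.≟ k) then f else 0ˢ

∑ᵗ : ∀ {A : Set} → List A → (A → Poly) → Poly
∑ᵗ xs P = List.foldr _+ᵗ_ 0ᵗ (List.map P xs)

-- The sum of all monomials of total degree n.
h : ℕ → Series
h n m e = if does (Vec.sum e ℕ.≟ n) then 1ℤ else 0ℤ

words : ∀ {A : Set} → List A → (n : ℕ) → List (Vec A n)
words xs zero    = [] ∷ []
words xs (suc n) = cartesianProductWith _∷_ xs (words xs n)

-- A subset of [n-1] is a Subset (pred n), with j : Fin (pred n) standing for
-- the element j + 1; the letters in positions j + 1 and j + 2 of a word of
-- length n = suc k are its entries at inject₁ j and suc j.

-- i ∈ Fin m stands for the index i + 1.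
Admissible : ∀ {k m} → Subset k → Vec (Fin m) (suc k) → Set
Admissible S i =
    (∀ j → lookup i (suc j) Fin.≤ lookup i (inject₁ j))
  × (∀ j → j ∈ S → lookup i (suc j) Fin.< lookup i (inject₁ j))

admissible? : ∀ {k m} (S : Subset k) (i : Vec (Fin m) (suc k)) → Dec (Admissible S i)
admissible? S i =
        all? (λ j → lookup i (suc j) Fin.≤? lookup i (inject₁ j))
  ×-dec all? (λ j → (j ∈? S) →-dec (lookup i (suc j) Fin.<? lookup i (inject₁ j)))

-- The exponent vector of x_{i₁} ⋯ x_{iₙ}.
content : ∀ {n m} → Vec (Fin m) n → Vec ℕ m
content i = tabulate λ v → count (v Fin.≟_) i

-- The coefficient of a monomial in the variables x₁, …, xₘ is the number of
-- admissible index sequences producing it; these have all indices in [m].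
F : (n : ℕ) → Subset (pred n) → Series
F zero    _     = 1ˢ
F (suc k) S m e =
  + length (filter (λ i → admissible? S i ×-dec Vec.≡-dec ℕ._≟_ (content i) e)
                   (words (allFin m) (suc k)))

DES : ∀ {A : Set} {_≺_ : Rel A 0ℓ} → Decidable _≺_ → ∀ {n} → Vec A n → Subset (pred n)
DES _≺?_ {zero}  w = []
DES _≺?_ {suc k} w = tabulate λ j → does (lookup w (suc j) ≺? lookup w (inject₁ j))

-- inj₁ a is the barred letter a, and inj₂ a the unbarred one: every barred
-- letter precedes every unbarred letter (including 0).
Letter : Set
Letter = ℕ ⊎ ℕ

_≺?_ : Decidable (ℕ._<_ ⊎-< ℕ._<_)
_≺?_ = ⊎-<-decidable ℕ._<?_ ℕ._<?_

-- EXC, exc, bar and DEX are shared by permutations and decorated permutations,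
-- both written as words w₁ ⋯ wₙ with letters in {0, …, n}; the position
-- i : Fin n stands for i + 1.

EXC : ∀ {n} → Vec ℕ n → Subset n
EXC w = tabulate λ i → does (suc (toℕ i) ℕ.<? lookup w i)

exc : ∀ {n} → Vec ℕ n → ℕ
exc w = ∣ EXC w ∣

bar : ∀ {n} → Vec ℕ n → Vec Letter n
bar w = tabulate λ i → if does (i ∈? EXC w) then inj₁ (lookup w i) else inj₂ (lookup w i)

DEX : ∀ {n} → Vec ℕ n → Subset (pred n)
DEX w = DES _≺?_ (bar w)

-- One-line notation of the elements of 𝔖ₖ, with v : Fin k standing for v + 1.
𝔖 : (k : ℕ) → List (Vec (Fin k) k)
𝔖 k = filter (allPairs? (λ u v → ¬? (u Fin.≟ v))) (words (allFin k) k)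

oneLine : ∀ {k} → Vec (Fin k) k → Vec ℕ k
oneLine = Vec.map (λ v → suc (toℕ v))

Q : ℕ → Poly
Q k = ∑ᵗ (𝔖 k) λ σ → F k (DEX (oneLine σ)) t^ exc (oneLine σ)

Q̃ : ℕ → Poly
Q̃ n = (h n t^ 0) +ᵗ t· ∑ᵗ (List.map suc (upTo n)) λ k → h (n ∸ k) ·ᵗ Q k

-- A decorated permutation is a word over {0, …, n}: here the letter
-- suc j : Fin (suc n) is the image j + 1, while the position j : Fin n also
-- stands for j + 1.  With S the set of positions of nonzero letters, the three
-- conditions say that σ is injective on S, maps S into S, and maps S onto S.
IsDecorated : ∀ {n} → Vec (Fin (suc n)) n → Set
IsDecorated σ =
    (∀ i j → lookup σ i ≢ zero → lookup σ i ≡ lookup σ j → i ≡ j)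
  × (∀ i j → lookup σ i ≡ suc j → lookup σ j ≢ zero)
  × (∀ j → lookup σ j ≢ zero → ∃[ i ] lookup σ i ≡ suc j)

isDecorated? : ∀ {n} (σ : Vec (Fin (suc n)) n) → Dec (IsDecorated σ)
isDecorated? σ =
        all? (λ i → all? λ j → ¬? (lookup σ i Fin.≟ zero)
               →-dec ((lookup σ i Fin.≟ lookup σ j) →-dec (i Fin.≟ j)))
  ×-dec all? (λ i → all? λ j → (lookup σ i Fin.≟ suc j)
               →-dec ¬? (lookup σ j Fin.≟ zero))
  ×-dec all? (λ j → ¬? (lookup σ j Fin.≟ zero)
               →-dec any? (λ i → lookup σ i Fin.≟ suc j))

𝔖̃ : (n : ℕ) → List (Vec (Fin (suc n)) n)
𝔖̃ n = filter isDecorated? (words (allFin (suc n)) n)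

θ : ∀ {n} → Vec (Fin (suc n)) n
θ = replicate _ zero

isθ? : ∀ {n} (σ : Vec (Fin (suc n)) n) → Dec (σ ≡ θ)
isθ? σ = Vec.≡-dec Fin._≟_ σ θ

exc~ : ∀ {n} → Vec (Fin (suc n)) n → ℤ
exc~ σ = if does (isθ? σ) then -1ℤ else + exc (Vec.map toℕ σ)

DEX~ : ∀ {n} → Vec (Fin (suc n)) n → Subset (pred n)
DEX~ σ = if does (isθ? σ) then ⊥ else DEX (Vec.map toℕ σ)

-- The coefficient of a monomial in F_{DES(w)} is 0 or 1: it is 1 when w, cut
-- into consecutive blocks whose lengths are the exponents, those of the later
-- variables first, has no descent inside a block.  Cutting is compatible with
-- shuffling, and an increasing block shuffled with copies of a letter z foreign
-- to it stays increasing in exactly one way.  Hence h_{n-k} F_{DES(u)} is the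
-- sum of F_{DES(w)} over the shuffles w of u with z^{n-k}.  A decorated
-- permutation other than θ is a permutation of [k] spread over a k-subset of
-- [n]; this preserves exc, and its barred word has the same descents as the
-- corresponding shuffle of the barred word of the permutation with 0^{n-k}.

module Submission where

open import Defs
import Algebra.Properties.CommutativeSemigroup as CommutativeSemigroup
open import Data.Bool.Base using (Bool; true; false; if_then_else_)
open import Data.Fin.Base as Fin using (Fin; zero; suc; toℕ; inject₁)
import Data.Fin.Properties as Fin
open import Data.Fin.Subset as Subset using (Subset)
open import Data.Fin.Subset.Properties using (_∈?_)
open import Data.Integer.Base as ℤ using (ℤ; +_; 0ℤ; 1ℤ; -1ℤ; ∣_∣)
import Data.Integer.Properties as ℤ
open import Data.Integer.Properties using (_≟_)
open import Data.List.Base as List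
  using (List; []; _∷_; _++_; allFin; cartesianProductWith; concatMap; drop; filter; length; map;
         replicate; take; upTo; zip)
open import Data.List.Membership.Propositional using (_∈_)
open import Data.List.Membership.Propositional.Properties
  using (∈-++⁺ˡ; ∈-++⁺ʳ; ∈-allFin; ∈-cartesianProductWith⁺; ∈-cartesianProductWith⁻; ∈-concatMap⁺;
         ∈-concatMap⁻; ∈-filter⁺; ∈-filter⁻; ∈-length; ∈-map⁺; ∈-map⁻; ∈-upTo⁺; ∈-upTo⁻)
open import Data.List.Membership.Propositional.Properties.WithK using (unique∧set⇒bag)
import Data.List.Properties as List
open import Data.List.Relation.Binary.BagAndSetEquality using (∼bag⇒↭)
open import Data.List.Relation.Binary.Permutation.Propositional using (_↭_; ↭⇒↭ₛ)
import Data.List.Relation.Binary.Permutation.Propositional.Properties as ↭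
import Data.List.Relation.Binary.Permutation.Setoid.Properties as ↭ₛ
open import Data.List.Relation.Unary.All as All using (All; []; _∷_)
import Data.List.Relation.Unary.All.Properties as All
open import Data.List.Relation.Unary.AllPairs as AllPairs using (AllPairs; []; _∷_)
import Data.List.Relation.Unary.AllPairs.Properties as AllPairs
open import Data.List.Relation.Unary.Any as Any using (here; there)
open import Data.List.Relation.Unary.Linked using (Linked; [-]; _∷_)
import Data.List.Relation.Unary.Linked.Properties as Linked
import Data.List.Relation.Unary.Unique.Propositional as List
import Data.List.Relation.Unary.Unique.Propositional.Properties as Unique
open import Data.Nat.Base as ℕ using (ℕ; zero; suc; _∸_; _≤_; s≤s; s<s; s<s⁻¹; z≤n; z<s)
import Data.Nat.Properties as ℕ
open import Data.Product.Base using (Σ; _×_; _,_; ∃-syntax; map₁; proj₁; proj₂)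
open import Data.Sum.Base using (_⊎_; inj₁; inj₂)
open import Data.Sum.Relation.Binary.LeftOrder
  using (_⊎-<_; ₁∼₁; ₁∼₂; ₂∼₂; ⊎-<-isStrictTotalOrder)
open import Data.Sum.Relation.Binary.Pointwise using (Pointwise; inj₁; inj₂)
open import Data.Vec.Base as Vec using (Vec; []; _∷_; lookup; tabulate; toList)
import Data.Vec.Properties as Vec
open import Data.Vec.Relation.Unary.AllPairs using (allPairs?)
open import Data.Vec.Relation.Unary.Unique.Propositional using (Unique)
import Data.Vec.Relation.Unary.Unique.Propositional.Properties as VecUnique
open import Function.Base using (_∘_; id)
open import Function.Bundles using (_⇔_; mk⇔)
open import Level using (0ℓ)
open import Relation.Binary.Core using (Rel)
open import Relation.Binary.Definitions using (Decidable; Transitive; tri<; tri≈; tri>)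
open import Relation.Binary.PropositionalEquality
open import Relation.Binary.Structures using (IsStrictTotalOrder)
open import Relation.Nullary.Decidable
  using (Dec; yes; no; does; ¬?; _×-dec_; _→-dec_; dec-false; dec-true; does-⇔)
open import Relation.Nullary.Negation using (¬_; contradiction)
open import Relation.Unary using () renaming (Decidable to Decidable₁)

open ≡-Reasoning
module +ℕ = CommutativeSemigroup ℕ.+-commutativeSemigroup
module +ℤ = CommutativeSemigroup ℤ.+-commutativeSemigroup
module *ℤ = CommutativeSemigroup ℤ.*-commutativeSemigroup

-- The product with h is compared one exponent vector `e` at a time, by induction on the number of
-- variables. Shuffles are therefore indexed by their total length, which is the degree `Vec.sum e`,
-- and not by the number of copies of `z`: a cut of the shuffle then has a fixed place, while the
-- cut of `u` stays free and is summed over. In a block of size k, the number i of copies of `z` is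
-- the share of the exponent k that goes to h, and the k - i letters of `u` are the share that goes
-- to F; this matches shuffles with splittings of `e`. Sums over shuffles take an arbitrary weight,
-- so that the recursion can absorb the first letter into it. The barred word of a decorated
-- permutation is not literally a shuffle of the barred word of the permutation with zeros, because
-- its values are relabelled from [k] to [n]. Only the comparisons of letters agree, and descents
-- depend on nothing else. The empty subset yields `θ` alone. The convention exc = -1 gives it the
-- exponent 0, and its descent set is that of a word of zeros, whose fundamental function is h of
-- degree n.

private
  variable
    A B C : Set
    k k′ m n : ℕ

-- Sums of integers over lists

unique∧set⇒↭ : {xs ys : List A} → List.Unique xs → List.Unique ys →
  (∀ {x} → x ∈ xs → x ∈ ys) → (∀ {x} → x ∈ ys → x ∈ xs) → xs ↭ ys
unique∧set⇒↭ xs! ys! to from = ∼bag⇒↭ (unique∧set⇒bag xs! ys! (mk⇔ to from))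

𝟙 : {P : Set} → Dec P → ℤ
𝟙 p = if does p then 1ℤ else 0ℤ

𝟙-yes : {P : Set} (p? : Dec P) → P → 𝟙 p? ≡ 1ℤ
𝟙-yes (yes _) _ = refl
𝟙-yes (no ¬p) p = contradiction p ¬p

𝟙-no : {P : Set} (p? : Dec P) → ¬ P → 𝟙 p? ≡ 0ℤ
𝟙-no (no _)  _  = refl
𝟙-no (yes p) ¬p = contradiction p ¬p

𝟙-⇔ : {P Q : Set} (p? : Dec P) (q? : Dec Q) → (P → Q) → (Q → P) → 𝟙 p? ≡ 𝟙 q?
𝟙-⇔ (yes p) q? to from = sym (𝟙-yes q? (to p))
𝟙-⇔ (no ¬p) q? to from = sym (𝟙-no q? (¬p ∘ from))

𝟙-× : {P Q : Set} (p? : Dec P) (q? : Dec Q) → 𝟙 (p? ×-dec q?) ≡ 𝟙 p? ℤ.* 𝟙 q?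
𝟙-× (yes _) q? = sym (ℤ.*-identityˡ (𝟙 q?))
𝟙-× (no _)  q? = sym (ℤ.*-zeroˡ (𝟙 q?))

∑ : List A → (A → ℤ) → ℤ
∑ xs f = sumℤ (map f xs)

∑-cong : (xs : List A) {f g : A → ℤ} → (∀ x → x ∈ xs → f x ≡ g x) → ∑ xs f ≡ ∑ xs g
∑-cong []       f≡g = refl
∑-cong (x ∷ xs) f≡g = cong₂ ℤ._+_ (f≡g x (here refl)) (∑-cong xs λ y y∈ → f≡g y (there y∈))

∑-0 : (xs : List A) → ∑ xs (λ _ → 0ℤ) ≡ 0ℤ
∑-0 []       = refl
∑-0 (x ∷ xs) = trans (ℤ.+-identityˡ _) (∑-0 xs)

∑-zero : (xs : List A) {f : A → ℤ} → (∀ x → f x ≡ 0ℤ) → ∑ xs f ≡ 0ℤ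
∑-zero xs f≡0 = trans (∑-cong xs λ x _ → f≡0 x) (∑-0 xs)

∑-distrib-+ : (xs : List A) (f g : A → ℤ) → ∑ xs (λ x → f x ℤ.+ g x) ≡ ∑ xs f ℤ.+ ∑ xs g
∑-distrib-+ []       f g = refl
∑-distrib-+ (x ∷ xs) f g =
  trans (cong (ℤ._+_ (f x ℤ.+ g x)) (∑-distrib-+ xs f g)) (+ℤ.interchange (f x) (g x) (∑ xs f) (∑ xs g))

*-distribˡ-∑ : (xs : List A) (c : ℤ) (f : A → ℤ) → c ℤ.* ∑ xs f ≡ ∑ xs (λ x → c ℤ.* f x)
*-distribˡ-∑ []       c f = ℤ.*-zeroʳ c
*-distribˡ-∑ (x ∷ xs) c f =
  trans (ℤ.*-distribˡ-+ c (f x) (∑ xs f)) (cong (ℤ._+_ (c ℤ.* f x)) (*-distribˡ-∑ xs c f))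

*-distribʳ-∑ : (xs : List A) (c : ℤ) (f : A → ℤ) → ∑ xs f ℤ.* c ≡ ∑ xs (λ x → f x ℤ.* c)
*-distribʳ-∑ xs c f =
  trans (ℤ.*-comm (∑ xs f) c) (trans (*-distribˡ-∑ xs c f) (∑-cong xs λ x _ → ℤ.*-comm c (f x)))

∑-++ : (xs ys : List A) (f : A → ℤ) → ∑ (xs ++ ys) f ≡ ∑ xs f ℤ.+ ∑ ys f
∑-++ []       ys f = sym (ℤ.+-identityˡ _)
∑-++ (x ∷ xs) ys f = trans (cong (ℤ._+_ (f x)) (∑-++ xs ys f)) (sym (ℤ.+-assoc (f x) (∑ xs f) (∑ ys f)))

∑-map : (g : A → B) (xs : List A) (f : B → ℤ) → ∑ (map g xs) f ≡ ∑ xs (f ∘ g)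
∑-map g xs f = cong sumℤ (sym (List.map-∘ xs))

∑-comm : (xs : List A) (ys : List B) (f : A → B → ℤ) →
  ∑ xs (λ x → ∑ ys (f x)) ≡ ∑ ys (λ y → ∑ xs (λ x → f x y))
∑-comm []       ys f = sym (∑-0 ys)
∑-comm (x ∷ xs) ys f =
  trans (cong (ℤ._+_ (∑ ys (f x))) (∑-comm xs ys f)) (sym (∑-distrib-+ ys (f x) _))

∑-concatMap : (g : A → List B) (xs : List A) (f : B → ℤ) →
  ∑ (concatMap g xs) f ≡ ∑ xs (λ x → ∑ (g x) f)
∑-concatMap g []       f = refl
∑-concatMap g (x ∷ xs) f = trans (∑-++ (g x) _ f) (cong (ℤ._+_ (∑ (g x) f)) (∑-concatMap g xs f))

∑-cartesianProductWith : (g : A → B → C) (xs : List A) (ys : List B) (f : C → ℤ) →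
  ∑ (cartesianProductWith g xs ys) f ≡ ∑ xs (λ x → ∑ ys (λ y → f (g x y)))
∑-cartesianProductWith g []       ys f = refl
∑-cartesianProductWith g (x ∷ xs) ys f =
  trans (∑-++ (map (g x) ys) _ f)
        (cong₂ ℤ._+_ (∑-map (g x) ys f) (∑-cartesianProductWith g xs ys f))

∑-upTo-suc : ∀ n (f : ℕ → ℤ) → ∑ (upTo (suc n)) f ≡ f 0 ℤ.+ ∑ (upTo n) (f ∘ suc)
∑-upTo-suc n f = cong (ℤ._+_ (f 0))
  (trans (cong (λ is → ∑ is f) (sym (List.map-applyUpTo id suc n))) (∑-map suc (upTo n) f))

∑-filter : {P : A → Set} (P? : Decidable₁ P) (xs : List A) (f : A → ℤ) →
  ∑ (filter P? xs) f ≡ ∑ xs (λ x → if does (P? x) then f x else 0ℤ)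
∑-filter P? []       f = refl
∑-filter P? (x ∷ xs) f with does (P? x)
... | true  = cong (ℤ._+_ (f x)) (∑-filter P? xs f)
... | false = trans (∑-filter P? xs f) (sym (ℤ.+-identityˡ _))

∑-↭ : {xs ys : List A} (f : A → ℤ) → xs ↭ ys → ∑ xs f ≡ ∑ ys f
∑-↭ f xs↭ys = ↭ₛ.foldr-commMonoid (setoid ℤ) ℤ.+-0-isCommutativeMonoid (↭⇒↭ₛ (↭.map⁺ f xs↭ys))

-- Coefficients of fundamental quasisymmetric functions

words-unique : {xs : List A} → List.Unique xs → ∀ n → List.Unique (words xs n)
words-unique xs! zero    = [] ∷ []
words-unique xs! (suc n) = Unique.cartesianProductWith⁺ _∷_ Vec.∷-injective xs! (words-unique xs! n)

∈-words : {xs : List A} → (∀ x → x ∈ xs) → (v : Vec A n) → v ∈ words xs n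
∈-words ∈xs []      = here refl
∈-words ∈xs (x ∷ v) = ∈-cartesianProductWith⁺ _∷_ (∈xs x) (∈-words ∈xs v)

occ : Fin m → List (Fin m) → ℕ
occ v xs = length (filter (v Fin.≟_) xs)

Decreasing : List (Fin m) → Set
Decreasing = AllPairs λ i j → j Fin.≤ i

occ-∈ : {v : Fin m} (xs ys : List (Fin m)) → occ v xs ≡ occ v ys → v ∈ xs → v ∈ ys
occ-∈ {v = v} xs ys eq v∈xs
  with filter (v Fin.≟_) ys in fys | subst (0 ℕ.<_) eq (∈-length (∈-filter⁺ (v Fin.≟_) v∈xs refl))
... | z ∷ zs | _
  with ∈-filter⁻ (v Fin.≟_) {xs = ys} (subst (z ∈_) (sym fys) (here refl))
... | z∈ys , refl = z∈ys

occ-∷-cancel : (v x : Fin m) (xs ys : List (Fin m)) → occ v (x ∷ xs) ≡ occ v (x ∷ ys) → occ v xs ≡ occ v ys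
occ-∷-cancel v x xs ys eq with does (v Fin.≟ x)
... | true  = ℕ.suc-injective eq
... | false = eq

head-max : {x y : Fin m} {xs : List (Fin m)} → Decreasing (x ∷ xs) → y ∈ x ∷ xs → y Fin.≤ x
head-max _          (here refl) = ℕ.≤-refl
head-max (x≥xs ∷ _) (there y∈)  = All.lookup x≥xs y∈

-- Each list begins with its largest letter, and equal counts give both lists the same letters. So
-- the heads agree, and cancelling them keeps the counts equal.
decreasing-unique : {xs ys : List (Fin m)} → Decreasing xs → Decreasing ys →
  (∀ v → occ v xs ≡ occ v ys) → xs ≡ ys
decreasing-unique {xs = []}     {[]}     _ _ _  = refl
decreasing-unique {xs = []}     {y ∷ ys} _ _ eq with occ-∈ (y ∷ ys) [] (sym (eq y)) (here refl)
... | ()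
decreasing-unique {xs = x ∷ xs} {[]}     _ _ eq with occ-∈ (x ∷ xs) [] (eq x) (here refl)
... | ()
decreasing-unique {xs = x ∷ xs} {y ∷ ys} xs↘@(_ ∷ xs↘′) ys↘@(_ ∷ ys↘′) eq
  with Fin.≤-antisym (head-max ys↘ (occ-∈ (x ∷ xs) (y ∷ ys) (eq x) (here refl)))
                     (head-max xs↘ (occ-∈ (y ∷ ys) (x ∷ xs) (sym (eq y)) (here refl)))
... | refl = cong (x ∷_) (decreasing-unique xs↘′ ys↘′ λ v → occ-∷-cancel v x xs ys (eq v))

-- The only candidate for an index sequence of content `e`. The first variable has the smallest
-- index, so its block comes last, and induction on `e` removes blocks from the right end of a word.
idx : Vec ℕ m → List (Fin m)
idx []      = []
idx (k ∷ e) = map suc (idx e) ++ replicate k zero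

length-idx : (e : Vec ℕ m) → length (idx e) ≡ Vec.sum e
length-idx []      = refl
length-idx (k ∷ e) = begin
  length (map suc (idx e) ++ replicate k zero)
    ≡⟨ List.length-++ (map suc (idx e)) ⟩
  length (map suc (idx e)) ℕ.+ length (replicate k (zero {n = _}))
    ≡⟨ cong₂ ℕ._+_ (trans (List.length-map suc (idx e)) (length-idx e)) (List.length-replicate k) ⟩
  Vec.sum e ℕ.+ k
    ≡⟨ ℕ.+-comm (Vec.sum e) k ⟩
  k ℕ.+ Vec.sum e ∎

idx-0 : ∀ m → idx (Vec.replicate m 0) ≡ []
idx-0 zero    = refl
idx-0 (suc m) rewrite idx-0 m = refl

replicate-AllPairs : {R : Rel A 0ℓ} (k : ℕ) {x : A} → R x x → AllPairs R (replicate k x)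
replicate-AllPairs zero    r = []
replicate-AllPairs (suc k) r = All.replicate⁺ k r ∷ replicate-AllPairs k r

idx-decreasing : (e : Vec ℕ m) → Decreasing (idx e)
idx-decreasing []      = []
idx-decreasing (k ∷ e) = AllPairs.++⁺
  (AllPairs.map⁺ (AllPairs.map s≤s (idx-decreasing e)))
  (replicate-AllPairs k z≤n)
  (All.universal (λ _ → All.replicate⁺ k z≤n) (map suc (idx e)))

occ-++ : (v : Fin m) (xs ys : List (Fin m)) → occ v (xs ++ ys) ≡ occ v xs ℕ.+ occ v ys
occ-++ v xs ys = trans (cong length (List.filter-++ (v Fin.≟_) xs ys))
                       (List.length-++ (filter (v Fin.≟_) xs))

occ-zero-map-suc : (xs : List (Fin m)) → occ zero (map suc xs) ≡ 0
occ-zero-map-suc []       = refl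
occ-zero-map-suc (x ∷ xs) = occ-zero-map-suc xs

occ-suc-map-suc : (v : Fin m) (xs : List (Fin m)) → occ (suc v) (map suc xs) ≡ occ v xs
occ-suc-map-suc v []       = refl
occ-suc-map-suc v (x ∷ xs) with does (v Fin.≟ x)
... | true  = cong suc (occ-suc-map-suc v xs)
... | false = occ-suc-map-suc v xs

occ-zero-replicate : ∀ k → occ (zero {n = m}) (replicate k zero) ≡ k
occ-zero-replicate zero    = refl
occ-zero-replicate (suc k) = cong suc (occ-zero-replicate k)

occ-suc-replicate : (v : Fin m) (k : ℕ) → occ (suc v) (replicate k zero) ≡ 0
occ-suc-replicate v zero    = refl
occ-suc-replicate v (suc k) = occ-suc-replicate v k

occ-idx : (e : Vec ℕ m) (v : Fin m) → occ v (idx e) ≡ lookup e v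
occ-idx (k ∷ e) zero    = trans (occ-++ zero (map suc (idx e)) _)
  (cong₂ ℕ._+_ (occ-zero-map-suc (idx e)) (occ-zero-replicate k))
occ-idx (k ∷ e) (suc v) = begin
  occ (suc v) (idx (k ∷ e))
    ≡⟨ occ-++ (suc v) (map suc (idx e)) _ ⟩
  occ (suc v) (map suc (idx e)) ℕ.+ occ (suc v) (replicate k zero)
    ≡⟨ cong₂ ℕ._+_ (trans (occ-suc-map-suc v (idx e)) (occ-idx e v)) (occ-suc-replicate v k) ⟩
  lookup e v ℕ.+ 0
    ≡⟨ ℕ.+-identityʳ _ ⟩
  lookup e v ∎

lookup-content : (i : Vec (Fin m) n) (v : Fin m) → lookup (content i) v ≡ occ v (toList i)
lookup-content i v = trans (Vec.lookup∘tabulate _ v) (count-occ i)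
  where
  count-occ : ∀ {n} (i : Vec _ n) → Vec.count (v Fin.≟_) i ≡ occ v (toList i)
  count-occ []      = refl
  count-occ (x ∷ i) with does (v Fin.≟ x)
  ... | true  = cong suc (count-occ i)
  ... | false = count-occ i

lookup-ext : {xs ys : Vec A n} → (∀ i → lookup xs i ≡ lookup ys i) → xs ≡ ys
lookup-ext {xs = xs} {ys} eq =
  trans (sym (Vec.tabulate∘lookup xs)) (trans (Vec.tabulate-cong eq) (Vec.tabulate∘lookup ys))

toList-injective : (xs ys : Vec A n) → toList xs ≡ toList ys → xs ≡ ys
toList-injective []       []       _  = refl
toList-injective (x ∷ xs) (y ∷ ys) eq =
  cong₂ _∷_ (List.∷-injectiveˡ eq) (toList-injective xs ys (List.∷-injectiveʳ eq))

content≡⇒idx : (i : Vec (Fin m) n) {e : Vec ℕ m} → Decreasing (toList i) → content i ≡ e → toList i ≡ idx e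
content≡⇒idx i i↘ refl = decreasing-unique i↘ (idx-decreasing (content i))
  λ v → trans (sym (lookup-content i v)) (sym (occ-idx (content i) v))

idx⇒content≡ : (i : Vec (Fin m) n) {e : Vec ℕ m} → toList i ≡ idx e → content i ≡ e
idx⇒content≡ i {e} eq = lookup-ext λ v →
  trans (lookup-content i v) (trans (cong (occ v) eq) (occ-idx e v))

zip-++ : (xs ys : List A) (us vs : List B) → length xs ≡ length us →
  zip (xs ++ ys) (us ++ vs) ≡ zip xs us ++ zip ys vs
zip-++ []       ys []       vs eq = refl
zip-++ (x ∷ xs) ys (u ∷ us) vs eq = cong (_ ∷_) (zip-++ xs ys us vs (ℕ.suc-injective eq))

zip-map₁ : (f : A → C) (xs : List A) (us : List B) → zip (map f xs) us ≡ map (map₁ f) (zip xs us)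
zip-map₁ f []       us       = refl
zip-map₁ f (x ∷ xs) []       = refl
zip-map₁ f (x ∷ xs) (u ∷ us) = cong (_ ∷_) (zip-map₁ f xs us)

zip-replicate : (x : A) (us : List B) → zip (replicate (length us) x) us ≡ map (x ,_) us
zip-replicate x []       = refl
zip-replicate x (u ∷ us) = cong (_ ∷_) (zip-replicate x us)

AllPairs-++⁻ : {R : Rel A 0ℓ} (xs : List A) {ys : List A} →
  AllPairs R (xs ++ ys) → AllPairs R xs × AllPairs R ys
AllPairs-++⁻ []       rs       = [] , rs
AllPairs-++⁻ (x ∷ xs) (r ∷ rs) with AllPairs-++⁻ xs rs
... | rxs , rys = All.++⁻ˡ xs r ∷ rxs , rys

Linked-zip⁺ : {R : Rel (A × B) 0ℓ} {k : ℕ} (i : Vec A (suc k)) (w : Vec B (suc k)) →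
  (∀ j → R (lookup i (inject₁ j) , lookup w (inject₁ j)) (lookup i (suc j) , lookup w (suc j))) →
  Linked R (zip (toList i) (toList w))
Linked-zip⁺ (x ∷ [])        (a ∷ [])        r = [-]
Linked-zip⁺ (x ∷ i@(_ ∷ _)) (a ∷ w@(_ ∷ _)) r = r zero ∷ Linked-zip⁺ i w (r ∘ suc)

Linked-zip⁻ : {R : Rel (A × B) 0ℓ} {k : ℕ} (i : Vec A (suc k)) (w : Vec B (suc k)) →
  Linked R (zip (toList i) (toList w)) →
  ∀ j → R (lookup i (inject₁ j) , lookup w (inject₁ j)) (lookup i (suc j) , lookup w (suc j))
Linked-zip⁻ (x ∷ y ∷ i)     (a ∷ b ∷ w)     (r ∷ _) zero    = r
Linked-zip⁻ (x ∷ i@(_ ∷ _)) (a ∷ w@(_ ∷ _)) (_ ∷ r) (suc j) = Linked-zip⁻ i w r j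

∈-tabulateˢ⁺ : {P : Fin n → Set} (P? : ∀ j → Dec (P j)) {j : Fin n} → P j → j Subset.∈ tabulate (does ∘ P?)
∈-tabulateˢ⁺ P? {j} p = Vec.lookup⇒[]= j _ (trans (Vec.lookup∘tabulate _ j) (dec-true (P? j) p))

∈-tabulateˢ⁻ : {P : Fin n → Set} (P? : ∀ j → Dec (P j)) {j : Fin n} → j Subset.∈ tabulate (does ∘ P?) → P j
∈-tabulateˢ⁻ P? {j} j∈ with P? j | trans (sym (Vec.lookup∘tabulate (does ∘ P?) j)) (Vec.[]=⇒lookup j∈)
... | yes p | _ = p

vecOfLength : (xs : List A) → length xs ≡ n → ∃[ v ] toList {n = n} v ≡ xs
vecOfLength xs refl = Vec.fromList xs , Vec.toList∘fromList xs

length-filter-none : {P : A → Set} (P? : ∀ x → Dec (P x)) (xs : List A) → (∀ x → ¬ P x) →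
  length (filter P? xs) ≡ 0
length-filter-none P? xs ¬p = cong length (List.filter-none P? (All.universal ¬p xs))

length-filter-one : {P : A → Set} (P? : ∀ x → Dec (P x)) {xs : List A} {x : A} → List.Unique xs →
  x ∈ xs → P x → (∀ {y} → P y → y ≡ x) → length (filter P? xs) ≡ 1
length-filter-one P? {xs} {x} xs! x∈ px eq =
  ↭.↭-length (unique∧set⇒↭ (Unique.filter⁺ P? xs!) ([] ∷ [])
    (λ y∈ → here (eq (proj₂ (∈-filter⁻ P? {xs = xs} y∈))))
    λ where (here refl) → ∈-filter⁺ P? x∈ px)

-- Words that fit an exponent vector

module Fitting {A : Set} {_≈_ _≺_ : Rel A 0ℓ}
               (isSTO : IsStrictTotalOrder _≈_ _≺_) (_≺?_ : Decidable _≺_) where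

  module STO = IsStrictTotalOrder isSTO

  infix 4 _≼_ _≼?_
  -- Defined as the absence of a descent, which is the very test made by `DES`; letters related by
  -- `≈` need no separate treatment.
  _≼_ : Rel A 0ℓ
  a ≼ b = ¬ b ≺ a

  _≼?_ : Decidable _≼_
  a ≼? b = ¬? (b ≺? a)

  ≼-trans : Transitive _≼_
  ≼-trans {a} {b} {c} a≼b b≼c c≺a with STO.compare a b
  ... | tri< a≺b _ _ = b≼c (STO.trans c≺a a≺b)
  ... | tri≈ _ a≈b _ = b≼c (STO.<-respʳ-≈ a≈b c≺a)
  ... | tri> _ _ b≺a = a≼b b≺a

  ≺⇒≼ : ∀ {a b} → a ≺ b → a ≼ b
  ≺⇒≼ = STO.asym

  -- The weak lexicographic order on pairs of an index and a letter: indices decrease, and equal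
  -- indices require `a ≼ b`. Being transitive, it turns conditions on neighbours into conditions on
  -- all pairs, which are easy to split along a concatenation.
  R : Rel (Fin m × A) 0ℓ
  R (i , a) (j , b) = j Fin.≤ i × (b ≺ a → j Fin.< i)

  R? : Decidable (R {m})
  R? (i , a) (j , b) = (j Fin.≤? i) ×-dec ((b ≺? a) →-dec (j Fin.<? i))

  R-trans : Transitive (R {m})
  R-trans {i = i , a} {j , b} {l , c} (j≤i , ba) (l≤j , cb) = ℕ.≤-trans l≤j j≤i , strict
    where
    strict : c ≺ a → l Fin.< i
    -- Since `≼` is transitive, a descent from `a` to `c` forces a descent at one of the two steps,
    -- and the index drops strictly there.
    strict c≺a with b ≺? a | c ≺? b
    ... | yes b≺a | _       = ℕ.≤-<-trans l≤j (ba b≺a)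
    ... | no _    | yes c≺b = ℕ.<-≤-trans (cb c≺b) j≤i
    ... | no a≼b  | no b≼c  = contradiction c≺a (≼-trans a≼b b≼c)

  -- `zip` truncates, so the lengths are compared separately; through them the condition also fixes
  -- the degree of `e`.
  Fits : Vec ℕ m → List A → Set
  Fits e w = length (idx e) ≡ length w × AllPairs R (zip (idx e) w)

  fits? : (e : Vec ℕ m) (w : List A) → Dec (Fits e w)
  fits? e w = (length (idx e) ℕ.≟ length w) ×-dec AllPairs.allPairs? R? (zip (idx e) w)

  descent? : (w : Vec A (suc k)) (j : Fin k) → Dec (lookup w (suc j) ≺ lookup w (inject₁ j))
  descent? w j = lookup w (suc j) ≺? lookup w (inject₁ j)

  Admissible⇒AllPairs : (w : Vec A (suc k)) (i : Vec (Fin m) (suc k)) →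
    Admissible (DES _≺?_ w) i → AllPairs R (zip (toList i) (toList w))
  Admissible⇒AllPairs w i (weak , strict) = Linked.Linked⇒AllPairs R-trans
    (Linked-zip⁺ {R = R} i w λ j → weak j , λ b≺a → strict j (∈-tabulateˢ⁺ (descent? w) b≺a))

  AllPairs⇒Admissible : (w : Vec A (suc k)) (i : Vec (Fin m) (suc k)) →
    AllPairs R (zip (toList i) (toList w)) → Admissible (DES _≺?_ w) i
  AllPairs⇒Admissible w i rs =
    (λ j → proj₁ (adj j)) , λ j j∈ → proj₂ (adj j) (∈-tabulateˢ⁻ (descent? w) j∈)
    where adj = Linked-zip⁻ {R = R} i w (Linked.AllPairs⇒Linked rs)

  Sorted⇒Decreasing : (is : List (Fin m)) (w : List A) → length is ≡ length w →
    AllPairs R (zip is w) → Decreasing is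
  Sorted⇒Decreasing []       []      _  []       = []
  Sorted⇒Decreasing (i ∷ is) (a ∷ w) eq (r ∷ rs) =
    first is w (ℕ.suc-injective eq) r ∷ Sorted⇒Decreasing is w (ℕ.suc-injective eq) rs
    where
    first : ∀ is w → length is ≡ length w → All (R (i , a)) (zip is w) → All (Fin._≤ i) is
    first []       []      _  []             = []
    first (j ∷ is) (b ∷ w) eq ((j≤i , _) ∷ r) = j≤i ∷ first is w (ℕ.suc-injective eq) r

  -- idx e is the only weakly decreasing word of content e.
  F-coefficient : (w : Vec A n) (e : Vec ℕ m) →
    F n (DES _≺?_ w) m e ≡ 𝟙 (fits? e (toList w))
  F-coefficient {m = m} [] e = 𝟙-⇔ (Vec.≡-dec ℕ._≟_ e (Vec.replicate m 0)) (fits? e []) to from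
    where
    to : e ≡ Vec.replicate m 0 → Fits e []
    to refl rewrite idx-0 m = refl , []
    from : Fits e [] → e ≡ Vec.replicate m 0
    from (eq , _) with idx e in ie
    ... | [] = lookup-ext λ v → trans (sym (occ-idx e v))
      (trans (cong (occ v) ie) (sym (Vec.lookup-replicate v 0)))
  F-coefficient {n = suc k} {m = m} w e with fits? e (toList w)
  ... | no ¬fits = trans (cong +_ none) (sym (𝟙-no (fits? e (toList w)) ¬fits))
    where
    none = length-filter-none _ (words (allFin m) (suc k)) λ i (adm , ci) →
      let len    = trans (Vec.length-toList i) (sym (Vec.length-toList w))
          sorted = Admissible⇒AllPairs w i adm
      in ¬fits (subst (λ is → length is ≡ length (toList w) × AllPairs R (zip is (toList w)))
                      (content≡⇒idx i (Sorted⇒Decreasing (toList i) (toList w) len sorted) ci)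
                      (len , sorted))
  ... | yes fits@(len , sorted) with vecOfLength (idx e) (trans len (Vec.length-toList w))
  ... | i , i≡ = trans (cong +_ one) (sym (𝟙-yes (fits? e (toList w)) fits))
    where
    one = length-filter-one _ (words-unique (Unique.allFin⁺ m) (suc k)) (∈-words ∈-allFin i)
      (AllPairs⇒Admissible w i (subst (λ is → AllPairs R (zip is (toList w))) (sym i≡) sorted)
        , idx⇒content≡ i i≡)
      λ {i′} (adm , ci′) →
        let len′ = trans (Vec.length-toList i′) (sym (Vec.length-toList w))
        in toList-injective i′ i (trans
             (content≡⇒idx i′ (Sorted⇒Decreasing (toList i′) (toList w) len′
               (Admissible⇒AllPairs w i′ adm)) ci′)
             (sym i≡))

-- Deconcatenation and shuffles

cuts : List A → List (List A × List A)
cuts []      = ([] , []) ∷ []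
cuts (x ∷ w) = ([] , x ∷ w) ∷ map (map₁ (x ∷_)) (cuts w)

∑-cuts-∷ : (x : A) (w : List A) (g c : List A → ℤ) →
  ∑ (cuts (x ∷ w)) (λ p → g (proj₁ p) ℤ.* c (proj₂ p)) ≡
  g [] ℤ.* c (x ∷ w) ℤ.+ ∑ (cuts w) (λ p → g (x ∷ proj₁ p) ℤ.* c (proj₂ p))
∑-cuts-∷ x w g c = cong (ℤ._+_ (g [] ℤ.* c (x ∷ w)))
  (∑-map (map₁ (x ∷_)) (cuts w) λ p → g (proj₁ p) ℤ.* c (proj₂ p))

-- A weight `g` supported on length `s` singles out the cut after `s` letters. If `w` is shorter
-- than `s`, `take` and `drop` give its last cut, so the formula holds there too.
∑-cuts-at : ∀ s (w : List A) (g c : List A → ℤ) → (∀ v → length v ≢ s → g v ≡ 0ℤ) →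
  ∑ (cuts w) (λ p → g (proj₁ p) ℤ.* c (proj₂ p)) ≡ g (take s w) ℤ.* c (drop s w)
∑-cuts-at zero    []      g c g≡0 = ℤ.+-identityʳ _
∑-cuts-at (suc s) []      g c g≡0 = ℤ.+-identityʳ _
∑-cuts-at zero    (x ∷ w) g c g≡0 = begin
  ∑ (cuts (x ∷ w)) (λ p → g (proj₁ p) ℤ.* c (proj₂ p))
    ≡⟨ ∑-cuts-∷ x w g c ⟩
  g [] ℤ.* c (x ∷ w) ℤ.+ ∑ (cuts w) (λ p → g (x ∷ proj₁ p) ℤ.* c (proj₂ p))
    ≡⟨ cong (ℤ._+_ (g [] ℤ.* c (x ∷ w)))
         (∑-zero (cuts w) λ p → cong (ℤ._* c (proj₂ p)) (g≡0 (x ∷ proj₁ p) λ ())) ⟩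
  g [] ℤ.* c (x ∷ w) ℤ.+ 0ℤ
    ≡⟨ ℤ.+-identityʳ _ ⟩
  g [] ℤ.* c (x ∷ w) ∎
∑-cuts-at (suc s) (x ∷ w) g c g≡0 = begin
  ∑ (cuts (x ∷ w)) (λ p → g (proj₁ p) ℤ.* c (proj₂ p))
    ≡⟨ ∑-cuts-∷ x w g c ⟩
  g [] ℤ.* c (x ∷ w) ℤ.+ ∑ (cuts w) (λ p → g (x ∷ proj₁ p) ℤ.* c (proj₂ p))
    ≡⟨ cong₂ ℤ._+_ (cong (ℤ._* c (x ∷ w)) (g≡0 [] λ ()))
         (∑-cuts-at s w (g ∘ (x ∷_)) c λ v v≢ → g≡0 (x ∷ v) (v≢ ∘ ℕ.suc-injective)) ⟩
  0ℤ ℤ.+ g (x ∷ take s w) ℤ.* c (drop s w)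
    ≡⟨ ℤ.+-identityˡ _ ⟩
  g (x ∷ take s w) ℤ.* c (drop s w) ∎

cuts-All : {P : A → Set} {w : List A} → All P w → ∀ p → p ∈ cuts w → All P (proj₁ p) × All P (proj₂ p)
cuts-All {w = w} pw p p∈ with cuts-++ w p p∈
  where
  cuts-++ : (w : List _) → ∀ p → p ∈ cuts w → proj₁ p ++ proj₂ p ≡ w
  cuts-++ []      p (here refl) = refl
  cuts-++ (x ∷ w) p (here refl) = refl
  cuts-++ (x ∷ w) p (there p∈) with ∈-map⁻ (map₁ (x ∷_)) p∈
  ... | q , q∈ , refl = cong (x ∷_) (cuts-++ w q q∈)
... | refl = All.++⁻ (proj₁ p) pw

-- The sum of f over the shuffles of u with a power of z that have length n.
shuffle∑ : A → ℕ → List A → (List A → ℤ) → ℤ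
shuffle∑ z zero    []      f = f []
shuffle∑ z zero    (x ∷ u) f = 0ℤ
shuffle∑ z (suc n) []      f = shuffle∑ z n [] (f ∘ (z ∷_))
shuffle∑ z (suc n) (x ∷ u) f = shuffle∑ z n u (f ∘ (x ∷_)) ℤ.+ shuffle∑ z n (x ∷ u) (f ∘ (z ∷_))

module _ {z : A} where

  shuffle∑-cong : ∀ n u {f g : List A → ℤ} → (∀ w → length w ≡ n → f w ≡ g w) →
    shuffle∑ z n u f ≡ shuffle∑ z n u g
  shuffle∑-cong zero    []      f≡g = f≡g [] refl
  shuffle∑-cong zero    (x ∷ u) f≡g = refl
  shuffle∑-cong (suc n) []      f≡g = shuffle∑-cong n [] λ w eq → f≡g (z ∷ w) (cong suc eq)
  shuffle∑-cong (suc n) (x ∷ u) f≡g = cong₂ ℤ._+_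
    (shuffle∑-cong n u λ w eq → f≡g (x ∷ w) (cong suc eq))
    (shuffle∑-cong n (x ∷ u) λ w eq → f≡g (z ∷ w) (cong suc eq))

  shuffle∑-*ˡ : ∀ n u (c : ℤ) (f : List A → ℤ) → shuffle∑ z n u (λ w → c ℤ.* f w) ≡ c ℤ.* shuffle∑ z n u f
  shuffle∑-*ˡ zero    []      c f = refl
  shuffle∑-*ˡ zero    (x ∷ u) c f = sym (ℤ.*-zeroʳ c)
  shuffle∑-*ˡ (suc n) []      c f = shuffle∑-*ˡ n [] c (f ∘ (z ∷_))
  shuffle∑-*ˡ (suc n) (x ∷ u) c f = trans
    (cong₂ ℤ._+_ (shuffle∑-*ˡ n u c (f ∘ (x ∷_))) (shuffle∑-*ˡ n (x ∷ u) c (f ∘ (z ∷_))))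
    (sym (ℤ.*-distribˡ-+ c (shuffle∑ z n u (f ∘ (x ∷_))) (shuffle∑ z n (x ∷ u) (f ∘ (z ∷_)))))

  shuffle∑-zero : ∀ n u {f : List A → ℤ} → (∀ w → length w ≡ n → f w ≡ 0ℤ) → shuffle∑ z n u f ≡ 0ℤ
  shuffle∑-zero n u {f} f≡0 = trans
    (shuffle∑-cong n u {g = λ w → 0ℤ ℤ.* f w} λ w eq → trans (f≡0 w eq) (sym (ℤ.*-zeroˡ (f w))))
    (trans (shuffle∑-*ˡ n u 0ℤ f) (ℤ.*-zeroˡ (shuffle∑ z n u f)))

  shuffle∑-short : ∀ n u (f : List A → ℤ) → n ℕ.< length u → shuffle∑ z n u f ≡ 0ℤ
  shuffle∑-short zero    (x ∷ u) f _         = refl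
  shuffle∑-short (suc n) (x ∷ u) f (s≤s n<u) = cong₂ ℤ._+_
    (shuffle∑-short n u (f ∘ (x ∷_)) n<u) (shuffle∑-short n (x ∷ u) (f ∘ (z ∷_)) (ℕ.m<n⇒m<1+n n<u))

  shuffle∑-exact : ∀ u (f : List A → ℤ) → shuffle∑ z (length u) u f ≡ f u
  shuffle∑-exact []      f = refl
  shuffle∑-exact (x ∷ u) f = trans
    (cong₂ ℤ._+_ (shuffle∑-exact u (f ∘ (x ∷_))) (shuffle∑-short (length u) (x ∷ u) (f ∘ (z ∷_)) ℕ.≤-refl))
    (ℤ.+-identityʳ _)

  -- Deconcatenation is multiplicative for the shuffle product.
  shuffle∑-cut : ∀ s k u (g c : List A → ℤ) →
    shuffle∑ z (s ℕ.+ k) u (λ w → g (take s w) ℤ.* c (drop s w)) ≡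
    ∑ (cuts u) (λ p → shuffle∑ z s (proj₁ p) g ℤ.* shuffle∑ z k (proj₂ p) c)
  shuffle∑-cut zero k [] g c = trans (shuffle∑-*ˡ k [] (g []) c) (sym (ℤ.+-identityʳ _))
  shuffle∑-cut zero k (x ∷ u) g c = begin
    shuffle∑ z k (x ∷ u) (λ w → g [] ℤ.* c w)
      ≡⟨ shuffle∑-*ˡ k (x ∷ u) (g []) c ⟩
    g [] ℤ.* shuffle∑ z k (x ∷ u) c
      ≡⟨ ℤ.+-identityʳ _ ⟨
    g [] ℤ.* shuffle∑ z k (x ∷ u) c ℤ.+ 0ℤ
      ≡⟨ cong (ℤ._+_ (g [] ℤ.* shuffle∑ z k (x ∷ u) c))
           (∑-zero (cuts u) λ p → ℤ.*-zeroˡ (shuffle∑ z k (proj₂ p) c)) ⟨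
    g [] ℤ.* shuffle∑ z k (x ∷ u) c ℤ.+ ∑ (cuts u) (λ p → 0ℤ ℤ.* shuffle∑ z k (proj₂ p) c)
      ≡⟨ ∑-cuts-∷ x u (λ v → shuffle∑ z zero v g) (λ v → shuffle∑ z k v c) ⟨
    ∑ (cuts (x ∷ u)) (λ p → shuffle∑ z zero (proj₁ p) g ℤ.* shuffle∑ z k (proj₂ p) c) ∎
  shuffle∑-cut (suc s) k [] g c = shuffle∑-cut s k [] (g ∘ (z ∷_)) c
  shuffle∑-cut (suc s) k (x ∷ u) g c = begin
    shuffle∑ z (s ℕ.+ k) u (λ w → g (x ∷ take s w) ℤ.* c (drop s w))
      ℤ.+ shuffle∑ z (s ℕ.+ k) (x ∷ u) (λ w → g (z ∷ take s w) ℤ.* c (drop s w))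
      -- A shuffle that begins with `z` may leave the part of `x ∷ u` before the cut empty, one that
      -- begins with `x` may not. The extra cut `S₀` becomes the first summand on the right; the
      -- others combine by the recursion of `shuffle∑`.
      ≡⟨ cong₂ ℤ._+_ (shuffle∑-cut s k u (g ∘ (x ∷_)) c)
           (trans (shuffle∑-cut s k (x ∷ u) (g ∘ (z ∷_)) c)
             (∑-cuts-∷ x u (λ v → shuffle∑ z s v (g ∘ (z ∷_))) (λ v → shuffle∑ z k v c))) ⟩
    ∑ (cuts u) Sx ℤ.+ (S₀ ℤ.+ ∑ (cuts u) Sz)
      ≡⟨ +ℤ.x∙yz≈y∙xz (∑ (cuts u) Sx) S₀ (∑ (cuts u) Sz) ⟩
    S₀ ℤ.+ (∑ (cuts u) Sx ℤ.+ ∑ (cuts u) Sz)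
      ≡⟨ cong (ℤ._+_ S₀) (∑-distrib-+ (cuts u) Sx Sz) ⟨
    S₀ ℤ.+ ∑ (cuts u) (λ p → Sx p ℤ.+ Sz p)
      ≡⟨ cong (ℤ._+_ S₀) (∑-cong (cuts u) λ p _ → sym (ℤ.*-distribʳ-+ (shuffle∑ z k (proj₂ p) c)
           (shuffle∑ z s (proj₁ p) (g ∘ (x ∷_))) (shuffle∑ z s (x ∷ proj₁ p) (g ∘ (z ∷_))))) ⟩
    S₀ ℤ.+ ∑ (cuts u) (λ p → shuffle∑ z (suc s) (x ∷ proj₁ p) g ℤ.* shuffle∑ z k (proj₂ p) c)
      ≡⟨ ∑-cuts-∷ x u (λ v → shuffle∑ z (suc s) v g) (λ v → shuffle∑ z k v c) ⟨
    ∑ (cuts (x ∷ u)) (λ p → shuffle∑ z (suc s) (proj₁ p) g ℤ.* shuffle∑ z k (proj₂ p) c) ∎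
    where
    S₀ = shuffle∑ z s [] (g ∘ (z ∷_)) ℤ.* shuffle∑ z k (x ∷ u) c
    Sx Sz : List A × List A → ℤ
    Sx p = shuffle∑ z s (proj₁ p) (g ∘ (x ∷_)) ℤ.* shuffle∑ z k (proj₂ p) c
    Sz p = shuffle∑ z s (x ∷ proj₁ p) (g ∘ (z ∷_)) ℤ.* shuffle∑ z k (proj₂ p) c

  module _ {P : A → Set} (P? : ∀ x → Dec (P x)) where

    𝟙-all-∷ : ∀ x w → 𝟙 (All.all? P? (x ∷ w)) ≡ 𝟙 (P? x) ℤ.* 𝟙 (All.all? P? w)
    𝟙-all-∷ x w = trans
      (𝟙-⇔ (All.all? P? (x ∷ w)) (P? x ×-dec All.all? P? w) (λ where (p ∷ ps) → p , ps) λ (p , ps) → p ∷ ps)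
      (𝟙-× (P? x) (All.all? P? w))

    -- When `z` satisfies `P`, its copies have no influence on the condition, which is then the same
    -- constant for all shuffles of `u`.
    shuffle∑-all : P z → ∀ n u (f : List A → ℤ) →
      shuffle∑ z n u (λ w → 𝟙 (All.all? P? w) ℤ.* f w) ≡ 𝟙 (All.all? P? u) ℤ.* shuffle∑ z n u f
    shuffle∑-all pz zero    []      f = refl
    shuffle∑-all pz zero    (x ∷ u) f = sym (ℤ.*-zeroʳ (𝟙 (All.all? P? (x ∷ u))))
    shuffle∑-all pz (suc n) []      f = trans
      (shuffle∑-cong n [] λ w _ → cong (ℤ._* f (z ∷ w)) (drop-z w))
      (shuffle∑-all pz n [] (f ∘ (z ∷_)))
      where
      drop-z : ∀ w → 𝟙 (All.all? P? (z ∷ w)) ≡ 𝟙 (All.all? P? w)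
      drop-z w = 𝟙-⇔ (All.all? P? (z ∷ w)) (All.all? P? w) All.tail (pz ∷_)
    shuffle∑-all pz (suc n) (x ∷ u) f = begin
      shuffle∑ z n u (λ w → 𝟙 (All.all? P? (x ∷ w)) ℤ.* f (x ∷ w))
        ℤ.+ shuffle∑ z n (x ∷ u) (λ w → 𝟙 (All.all? P? (z ∷ w)) ℤ.* f (z ∷ w))
        ≡⟨ cong₂ ℤ._+_ first second ⟩
      𝟙 (All.all? P? (x ∷ u)) ℤ.* shuffle∑ z n u (f ∘ (x ∷_))
        ℤ.+ 𝟙 (All.all? P? (x ∷ u)) ℤ.* shuffle∑ z n (x ∷ u) (f ∘ (z ∷_))
        ≡⟨ ℤ.*-distribˡ-+ (𝟙 (All.all? P? (x ∷ u))) (shuffle∑ z n u (f ∘ (x ∷_)))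
             (shuffle∑ z n (x ∷ u) (f ∘ (z ∷_))) ⟨
      𝟙 (All.all? P? (x ∷ u)) ℤ.* shuffle∑ z (suc n) (x ∷ u) f ∎
      where
      first = begin
        shuffle∑ z n u (λ w → 𝟙 (All.all? P? (x ∷ w)) ℤ.* f (x ∷ w))
          ≡⟨ shuffle∑-cong n u (λ w _ → trans (cong (ℤ._* f (x ∷ w)) (𝟙-all-∷ x w))
               (ℤ.*-assoc (𝟙 (P? x)) (𝟙 (All.all? P? w)) (f (x ∷ w)))) ⟩
        shuffle∑ z n u (λ w → 𝟙 (P? x) ℤ.* (𝟙 (All.all? P? w) ℤ.* f (x ∷ w)))
          ≡⟨ shuffle∑-*ˡ n u (𝟙 (P? x)) _ ⟩
        𝟙 (P? x) ℤ.* shuffle∑ z n u (λ w → 𝟙 (All.all? P? w) ℤ.* f (x ∷ w))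
          ≡⟨ cong (ℤ._*_ (𝟙 (P? x))) (shuffle∑-all pz n u (f ∘ (x ∷_))) ⟩
        𝟙 (P? x) ℤ.* (𝟙 (All.all? P? u) ℤ.* shuffle∑ z n u (f ∘ (x ∷_)))
          ≡⟨ ℤ.*-assoc (𝟙 (P? x)) (𝟙 (All.all? P? u)) _ ⟨
        𝟙 (P? x) ℤ.* 𝟙 (All.all? P? u) ℤ.* shuffle∑ z n u (f ∘ (x ∷_))
          ≡⟨ cong (ℤ._* shuffle∑ z n u (f ∘ (x ∷_))) (𝟙-all-∷ x u) ⟨
        𝟙 (All.all? P? (x ∷ u)) ℤ.* shuffle∑ z n u (f ∘ (x ∷_)) ∎
      second = trans
        (shuffle∑-cong n (x ∷ u) λ w _ → cong (ℤ._* f (z ∷ w))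
          (𝟙-⇔ (All.all? P? (z ∷ w)) (All.all? P? w) All.tail (pz ∷_)))
        (shuffle∑-all pz n (x ∷ u) (f ∘ (z ∷_)))

    -- Since `u` has fewer than `n` letters, every shuffle of length `n` contains a `z`, which
    -- violates `P`.
    shuffle∑-all-zero : ¬ P z → ∀ n u (f : List A → ℤ) → length u ℕ.< n →
      shuffle∑ z n u (λ w → 𝟙 (All.all? P? w) ℤ.* f w) ≡ 0ℤ
    shuffle∑-all-zero ¬pz (suc n) u f u<n = helper u u<n
      where
      z-first : ∀ u → shuffle∑ z n u (λ w → 𝟙 (All.all? P? (z ∷ w)) ℤ.* f (z ∷ w)) ≡ 0ℤ
      z-first u = shuffle∑-zero n u λ w _ →
        cong (ℤ._* f (z ∷ w)) (𝟙-no (All.all? P? (z ∷ w)) (¬pz ∘ All.head))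
      helper : ∀ u → length u ℕ.< suc n → shuffle∑ z (suc n) u (λ w → 𝟙 (All.all? P? w) ℤ.* f w) ≡ 0ℤ
      helper []      _         = z-first []
      helper (x ∷ u) (s≤s u<n) = cong₂ ℤ._+_ (trans
        -- The test of the leading `x` is moved into the weight, which leaves a sum over shuffles of
        -- `u` to which the induction applies.
        (shuffle∑-cong n u {g = λ w → 𝟙 (All.all? P? w) ℤ.* (𝟙 (P? x) ℤ.* f (x ∷ w))} λ w _ →
          trans (cong (ℤ._* f (x ∷ w)) (trans (𝟙-all-∷ x w) (ℤ.*-comm (𝟙 (P? x)) (𝟙 (All.all? P? w)))))
                (ℤ.*-assoc (𝟙 (All.all? P? w)) (𝟙 (P? x)) (f (x ∷ w))))
        (shuffle∑-all-zero ¬pz n u _ u<n)) (z-first (x ∷ u))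

-- Shuffling a word with copies of one letter

-- As `i` runs from 0 to `k`, `k ∸ i` takes every value from 0 to `k` exactly once.
∑-≟-∸ : ∀ l k → ∑ (upTo (suc k)) (λ i → 𝟙 (l ℕ.≟ k ∸ i)) ≡ 𝟙 (l ℕ.≤? k)
∑-≟-∸ l zero    = trans (ℤ.+-identityʳ (𝟙 (l ℕ.≟ 0)))
  (𝟙-⇔ (l ℕ.≟ 0) (l ℕ.≤? 0) ℕ.≤-reflexive ℕ.n≤0⇒n≡0)
∑-≟-∸ l (suc k) = begin
  ∑ (upTo (suc (suc k))) (λ i → 𝟙 (l ℕ.≟ suc k ∸ i))
    ≡⟨ ∑-upTo-suc (suc k) (λ i → 𝟙 (l ℕ.≟ suc k ∸ i)) ⟩
  𝟙 (l ℕ.≟ suc k) ℤ.+ ∑ (upTo (suc k)) (λ i → 𝟙 (l ℕ.≟ k ∸ i))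
    ≡⟨ cong (ℤ._+_ (𝟙 (l ℕ.≟ suc k))) (∑-≟-∸ l k) ⟩
  𝟙 (l ℕ.≟ suc k) ℤ.+ 𝟙 (l ℕ.≤? k)
    ≡⟨ either ⟩
  𝟙 (l ℕ.≤? suc k) ∎
  where
  either : 𝟙 (l ℕ.≟ suc k) ℤ.+ 𝟙 (l ℕ.≤? k) ≡ 𝟙 (l ℕ.≤? suc k)
  either with ℕ.<-cmp l (suc k)
  ... | tri< l<1+k l≢ _ = trans
    (cong₂ ℤ._+_ (𝟙-no (l ℕ.≟ suc k) l≢) (𝟙-yes (l ℕ.≤? k) (ℕ.s≤s⁻¹ l<1+k)))
    (sym (𝟙-yes (l ℕ.≤? suc k) (ℕ.<⇒≤ l<1+k)))
  ... | tri≈ _ refl _   = trans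
    (cong₂ ℤ._+_ (𝟙-yes (l ℕ.≟ suc k) refl) (𝟙-no (l ℕ.≤? k) ℕ.1+n≰n))
    (sym (𝟙-yes (l ℕ.≤? suc k) ℕ.≤-refl))
  ... | tri> _ l≢ l>1+k = trans
    (cong₂ ℤ._+_ (𝟙-no (l ℕ.≟ suc k) l≢) (𝟙-no (l ℕ.≤? k) (ℕ.<⇒≱ (ℕ.<-trans (ℕ.n<1+n k) l>1+k))))
    (sym (𝟙-no (l ℕ.≤? suc k) (ℕ.<⇒≱ l>1+k)))

take-drop-exact : ∀ s (w : List A) {l} → length w ≡ s ℕ.+ l → length (take s w) ≡ s × length (drop s w) ≡ l
take-drop-exact zero    w       eq = refl , eq
take-drop-exact (suc s) (x ∷ w) eq with take-drop-exact s w (ℕ.suc-injective eq)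
... | p , q = cong suc p , q

module Shuffling {A : Set} {_≈_ _≺_ : Rel A 0ℓ}
                 (isSTO : IsStrictTotalOrder _≈_ _≺_) (_≺?_ : Decidable _≺_) (z : A) where

  open Fitting isSTO _≺?_

  Increasing : List A → Set
  Increasing = AllPairs _≼_

  increasing? : ∀ w → Dec (Increasing w)
  increasing? = AllPairs.allPairs? _≼?_

  -- The side of `z` on which a letter lies decides whether it or a copy of `z` comes first in an
  -- increasing shuffle.
  Separated : A → Set
  Separated x = x ≺ z ⊎ z ≺ x

  ≼-refl : ∀ {x} → x ≼ x
  ≼-refl = STO.irrefl STO.Eq.refl

  𝟙-increasing-∷ : ∀ x w → 𝟙 (increasing? (x ∷ w)) ≡ 𝟙 (All.all? (x ≼?_) w) ℤ.* 𝟙 (increasing? w)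
  𝟙-increasing-∷ x w = trans
    (𝟙-⇔ (increasing? (x ∷ w)) (All.all? (x ≼?_) w ×-dec increasing? w)
      (λ where (p ∷ ps) → p , ps) λ (p , ps) → p ∷ ps)
    (𝟙-× (All.all? (x ≼?_) w) (increasing? w))

  private
    Z : ℕ → List A → ℤ
    Z n u = shuffle∑ z n u (𝟙 ∘ increasing?)

    z-first : ∀ n u → shuffle∑ z n u (λ w → 𝟙 (increasing? (z ∷ w))) ≡ 𝟙 (All.all? (z ≼?_) u) ℤ.* Z n u
    z-first n u = trans (shuffle∑-cong n u λ w _ → 𝟙-increasing-∷ z w)
      (shuffle∑-all (z ≼?_) ≼-refl n u (𝟙 ∘ increasing?))

    x-first-≺ : ∀ {x} → x ≺ z → ∀ n u →
      shuffle∑ z n u (λ w → 𝟙 (increasing? (x ∷ w))) ≡ 𝟙 (All.all? (x ≼?_) u) ℤ.* Z n u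
    x-first-≺ {x} x≺z n u = trans (shuffle∑-cong n u λ w _ → 𝟙-increasing-∷ x w)
      (shuffle∑-all (x ≼?_) (≺⇒≼ x≺z) n u (𝟙 ∘ increasing?))

    x-first-≻ : ∀ {x} → z ≺ x → ∀ n u → length u ℕ.< n →
      shuffle∑ z n u (λ w → 𝟙 (increasing? (x ∷ w))) ≡ 0ℤ
    x-first-≻ {x} z≺x n u u<n = trans (shuffle∑-cong n u λ w _ → 𝟙-increasing-∷ x w)
      (shuffle∑-all-zero (x ≼?_) (λ x≼z → x≼z z≺x) n u (𝟙 ∘ increasing?) u<n)

  -- In an increasing shuffle the letters z sit between those below and those
  -- above z.
  shuffle∑-increasing : ∀ n {u} → All Separated u → Z n u ≡ 𝟙 (length u ℕ.≤? n) ℤ.* 𝟙 (increasing? u)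
  shuffle∑-increasing zero    {[]}    _ = refl
  shuffle∑-increasing zero    {x ∷ u} _ = sym (ℤ.*-zeroˡ (𝟙 (increasing? (x ∷ u))))
  shuffle∑-increasing (suc n) {[]}    _ =
    trans (z-first n []) (trans (ℤ.*-identityˡ _) (shuffle∑-increasing n []))
  shuffle∑-increasing (suc n) {x ∷ u} (inj₁ x≺z ∷ sep) = begin
    shuffle∑ z n u (λ w → 𝟙 (increasing? (x ∷ w)))
      ℤ.+ shuffle∑ z n (x ∷ u) (λ w → 𝟙 (increasing? (z ∷ w)))
      ≡⟨ cong₂ ℤ._+_ (x-first-≺ x≺z n u) (z-first n (x ∷ u)) ⟩
    ax ℤ.* Z n u ℤ.+ 𝟙 (All.all? (z ≼?_) (x ∷ u)) ℤ.* Z n (x ∷ u)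
      -- A leading `z` would precede `x`, which is smaller, so no increasing shuffle begins with
      -- `z`.
      ≡⟨ cong₂ ℤ._+_ (cong (ℤ._*_ ax) (shuffle∑-increasing n sep))
           (cong (ℤ._* Z n (x ∷ u)) (𝟙-no (All.all? (z ≼?_) (x ∷ u)) λ z≼ → All.head z≼ x≺z)) ⟩
    ax ℤ.* (l ℤ.* 𝟙 (increasing? u)) ℤ.+ 0ℤ
      ≡⟨ ℤ.+-identityʳ _ ⟩
    ax ℤ.* (l ℤ.* 𝟙 (increasing? u))
      ≡⟨ *ℤ.x∙yz≈y∙xz ax l (𝟙 (increasing? u)) ⟩
    l ℤ.* (ax ℤ.* 𝟙 (increasing? u))
      ≡⟨ cong₂ ℤ._*_ (𝟙-⇔ (length u ℕ.≤? n) (suc (length u) ℕ.≤? suc n) s≤s ℕ.s≤s⁻¹)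
           (sym (𝟙-increasing-∷ x u)) ⟩
    𝟙 (suc (length u) ℕ.≤? suc n) ℤ.* 𝟙 (increasing? (x ∷ u)) ∎
    where
    ax = 𝟙 (All.all? (x ≼?_) u)
    l = 𝟙 (length u ℕ.≤? n)
  -- An `x` above `z` can come first only when no copy of `z` is left. So either there are copies of
  -- `z` and one of them comes first, or `x ∷ u` fills all places by itself, or it is too long and
  -- has no shuffle.
  shuffle∑-increasing (suc n) {x ∷ u} sep@(inj₂ z≺x ∷ _) with ℕ.<-cmp (length u) n
  ... | tri< u<n _ _ = begin
    shuffle∑ z n u (λ w → 𝟙 (increasing? (x ∷ w)))
      ℤ.+ shuffle∑ z n (x ∷ u) (λ w → 𝟙 (increasing? (z ∷ w)))
      ≡⟨ cong₂ ℤ._+_ (x-first-≻ z≺x n u u<n) (z-first n (x ∷ u)) ⟩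
    0ℤ ℤ.+ az ℤ.* Z n (x ∷ u)
      ≡⟨ ℤ.+-identityˡ _ ⟩
    az ℤ.* Z n (x ∷ u)
      ≡⟨ cong (ℤ._*_ az) (trans (shuffle∑-increasing n sep)
           (trans (cong (ℤ._* ix) (𝟙-yes (suc (length u) ℕ.≤? n) u<n)) (ℤ.*-identityˡ ix))) ⟩
    az ℤ.* ix
      ≡⟨ 𝟙-× (All.all? (z ≼?_) (x ∷ u)) (increasing? (x ∷ u)) ⟨
    𝟙 (All.all? (z ≼?_) (x ∷ u) ×-dec increasing? (x ∷ u))
      ≡⟨ 𝟙-⇔ (All.all? (z ≼?_) (x ∷ u) ×-dec increasing? (x ∷ u)) (increasing? (x ∷ u)) proj₂
           (λ where inc@(x≼ ∷ _) → ≺⇒≼ z≺x ∷ All.map (≼-trans (≺⇒≼ z≺x)) x≼ , inc) ⟩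
    ix
      ≡⟨ ℤ.*-identityˡ ix ⟨
    1ℤ ℤ.* ix
      ≡⟨ cong (ℤ._* ix) (𝟙-yes (suc (length u) ℕ.≤? suc n) (s≤s (ℕ.<⇒≤ u<n))) ⟨
    𝟙 (suc (length u) ℕ.≤? suc n) ℤ.* ix ∎
    where
    az = 𝟙 (All.all? (z ≼?_) (x ∷ u))
    ix = 𝟙 (increasing? (x ∷ u))
  ... | tri≈ _ refl _ = trans (shuffle∑-exact (x ∷ u) (𝟙 ∘ increasing?))
    (sym (trans (cong (ℤ._* ix) (𝟙-yes (suc n ℕ.≤? suc n) ℕ.≤-refl)) (ℤ.*-identityˡ ix)))
    where ix = 𝟙 (increasing? (x ∷ u))
  ... | tri> _ _ u>n = trans (shuffle∑-short (suc n) (x ∷ u) (𝟙 ∘ increasing?) (s≤s u>n))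
    (sym (trans (cong (ℤ._* ix) (𝟙-no (suc (length u) ℕ.≤? suc n) (ℕ.<⇒≱ (s≤s u>n)))) (ℤ.*-zeroˡ ix)))
    where ix = 𝟙 (increasing? (x ∷ u))

  -- This is `Fits` for a single variable with exponent `k`.
  Block : ℕ → List A → Set
  Block k w = length w ≡ k × Increasing w

  block? : ∀ k w → Dec (Block k w)
  block? k w = (length w ℕ.≟ k) ×-dec increasing? w

  -- The one-variable case: a block of size `k` with `i` copies of `z` takes `k ∸ i` letters from
  -- `u`, and `i` is the share of the exponent that goes to the complete homogeneous factor.
  shuffle∑-block : ∀ k {u} → All Separated u →
    shuffle∑ z k u (𝟙 ∘ block? k) ≡ ∑ (upTo (suc k)) (λ i → 𝟙 (block? (k ∸ i) u))
  shuffle∑-block k {u} sep = begin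
    shuffle∑ z k u (𝟙 ∘ block? k)
      ≡⟨ shuffle∑-cong k u (λ w eq → 𝟙-⇔ (block? k w) (increasing? w) proj₂ (eq ,_)) ⟩
    Z k u
      ≡⟨ shuffle∑-increasing k sep ⟩
    𝟙 (length u ℕ.≤? k) ℤ.* 𝟙 (increasing? u)
      ≡⟨ cong (ℤ._* 𝟙 (increasing? u)) (∑-≟-∸ (length u) k) ⟨
    ∑ (upTo (suc k)) (λ i → 𝟙 (length u ℕ.≟ k ∸ i)) ℤ.* 𝟙 (increasing? u)
      ≡⟨ *-distribʳ-∑ (upTo (suc k)) (𝟙 (increasing? u)) (λ i → 𝟙 (length u ℕ.≟ k ∸ i)) ⟩
    ∑ (upTo (suc k)) (λ i → 𝟙 (length u ℕ.≟ k ∸ i) ℤ.* 𝟙 (increasing? u))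
      ≡⟨ ∑-cong (upTo (suc k)) (λ i _ → 𝟙-× (length u ℕ.≟ k ∸ i) (increasing? u)) ⟨
    ∑ (upTo (suc k)) (λ i → 𝟙 (block? (k ∸ i) u)) ∎

  zip-idx-∷ : (k : ℕ) (e : Vec ℕ m) (v w : List A) → length (idx e) ≡ length v → length w ≡ k →
    zip (idx (k ∷ e)) (v ++ w) ≡ map (map₁ suc) (zip (idx e) v) ++ map (zero ,_) w
  zip-idx-∷ k e v w ev refl = trans
    (zip-++ (map suc (idx e)) _ v w (trans (List.length-map suc (idx e)) ev))
    (cong₂ _++_ (zip-map₁ suc (idx e) v) (zip-replicate zero w))

  Fits-++⁺ : (k : ℕ) (e : Vec ℕ m) (v w : List A) → Fits e v → Block k w → Fits (k ∷ e) (v ++ w)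
  Fits-++⁺ k e v w (len , sorted) (refl , inc) =
    (begin
      length (idx (k ∷ e))     ≡⟨ length-idx (k ∷ e) ⟩
      k ℕ.+ Vec.sum e          ≡⟨ ℕ.+-comm k (Vec.sum e) ⟩
      Vec.sum e ℕ.+ k          ≡⟨ cong (ℕ._+ k) (trans (sym (length-idx e)) len) ⟩
      length v ℕ.+ length w    ≡⟨ List.length-++ v ⟨
      length (v ++ w)          ∎)
    , subst (AllPairs R) (sym (zip-idx-∷ k e v w len refl)) (AllPairs.++⁺
        (AllPairs.map⁺ (AllPairs.map (λ (j≤i , str) → s≤s j≤i , s≤s ∘ str) sorted))
        (AllPairs.map⁺ (AllPairs.map (λ a≼b → z≤n , λ b≺a → contradiction b≺a a≼b) inc))
        -- Between the two parts the index falls from a successor to `zero`, so nothing is asked of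
        -- the letters there.
        (All.map⁺ (All.universal (λ _ → All.map⁺ (All.universal (λ _ → z≤n , λ _ → s≤s z≤n) w))
          (zip (idx e) v))))

  Fits-++⁻ : (k : ℕ) (e : Vec ℕ m) (v w : List A) → length (idx e) ≡ length v → length w ≡ k →
    AllPairs R (zip (idx (k ∷ e)) (v ++ w)) → Fits e v × Block k w
  Fits-++⁻ k e v w ev ew sorted
    with AllPairs-++⁻ (map (map₁ suc) (zip (idx e) v))
           (subst (AllPairs R) (zip-idx-∷ k e v w ev ew) sorted)
  ... | sv , sw =
      (ev , AllPairs.map (λ (j≤i , str) → ℕ.s≤s⁻¹ j≤i , ℕ.s≤s⁻¹ ∘ str) (AllPairs.map⁻ sv))
    , (ew , AllPairs.map (λ (_ , str) b≺a → ℕ.n≮0 (str b≺a)) (AllPairs.map⁻ sw))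

  -- The first variable occupies the last `k` places of `idx (k ∷ e)`, hence the cut after
  -- `Vec.sum e` letters.
  𝟙-fits-∷ : (k : ℕ) (e : Vec ℕ m) (w : List A) →
    𝟙 (fits? (k ∷ e) w) ≡ 𝟙 (fits? e (take (Vec.sum e) w)) ℤ.* 𝟙 (block? k (drop (Vec.sum e) w))
  𝟙-fits-∷ k e w = trans
    (𝟙-⇔ (fits? (k ∷ e) w) (fits? e v ×-dec block? k v′) to from)
    (𝟙-× (fits? e v) (block? k v′))
    where
    v  = take (Vec.sum e) w
    v′ = drop (Vec.sum e) w
    to : Fits (k ∷ e) w → Fits e v × Block k v′
    to (len , sorted) with take-drop-exact (Vec.sum e) w
      (trans (sym len) (trans (length-idx (k ∷ e)) (ℕ.+-comm k (Vec.sum e))))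
    ... | lv , lv′ = Fits-++⁻ k e v v′ (trans (length-idx e) (sym lv)) lv′
      (subst (λ w → AllPairs R (zip (idx (k ∷ e)) w)) (sym (List.take++drop≡id (Vec.sum e) w)) sorted)
    from : Fits e v × Block k v′ → Fits (k ∷ e) w
    from (fv , bv′) = subst (Fits (k ∷ e)) (List.take++drop≡id (Vec.sum e) w) (Fits-++⁺ k e v v′ fv bv′)

  ∑-cuts-fits : (k : ℕ) (e : Vec ℕ m) (u : List A) →
    ∑ (cuts u) (λ p → 𝟙 (fits? e (proj₁ p)) ℤ.* 𝟙 (block? k (proj₂ p))) ≡ 𝟙 (fits? (k ∷ e) u)
  ∑-cuts-fits k e u = trans
    (∑-cuts-at (Vec.sum e) u (𝟙 ∘ fits? e) (𝟙 ∘ block? k)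
      λ v v≢ → 𝟙-no (fits? e v) λ (len , _) → v≢ (trans (sym len) (length-idx e)))
    (sym (𝟙-fits-∷ k e u))

  -- The right side is the coefficient of the product of F of `u` with the sum of all h: no degree
  -- is imposed on the first part of a split. The induction cuts the shuffles before the block of
  -- the first variable, evaluates both parts, and glues the two pieces of `u` together again.
  shuffle∑-fits : (e : Vec ℕ m) {u : List A} → All Separated u →
    shuffle∑ z (Vec.sum e) u (𝟙 ∘ fits? e) ≡ ∑ (splits e) (λ p → 𝟙 (fits? (proj₂ p) u))
  shuffle∑-fits []      {[]}    sep = refl
  shuffle∑-fits []      {x ∷ u} sep = refl
  shuffle∑-fits (k ∷ e) {u}     sep = begin
    shuffle∑ z (k ℕ.+ s) u (𝟙 ∘ fits? (k ∷ e))
      ≡⟨ cong (λ n → shuffle∑ z n u (𝟙 ∘ fits? (k ∷ e))) (ℕ.+-comm k s) ⟩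
    shuffle∑ z (s ℕ.+ k) u (𝟙 ∘ fits? (k ∷ e))
      ≡⟨ shuffle∑-cong (s ℕ.+ k) u (λ w _ → 𝟙-fits-∷ k e w) ⟩
    shuffle∑ z (s ℕ.+ k) u (λ w → 𝟙 (fits? e (take s w)) ℤ.* 𝟙 (block? k (drop s w)))
      ≡⟨ shuffle∑-cut s k u (𝟙 ∘ fits? e) (𝟙 ∘ block? k) ⟩
    ∑ (cuts u) (λ p → shuffle∑ z s (proj₁ p) (𝟙 ∘ fits? e) ℤ.* shuffle∑ z k (proj₂ p) (𝟙 ∘ block? k))
      ≡⟨ ∑-cong (cuts u) (λ p p∈ → let sep₁ , sep₂ = cuts-All sep p p∈ in begin
           shuffle∑ z s (proj₁ p) (𝟙 ∘ fits? e) ℤ.* shuffle∑ z k (proj₂ p) (𝟙 ∘ block? k)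
             ≡⟨ cong₂ ℤ._*_ (shuffle∑-fits e sep₁) (shuffle∑-block k sep₂) ⟩
           ∑ (splits e) (fit p) ℤ.* ∑ (upTo (suc k)) (λ i → 𝟙 (block? (k ∸ i) (proj₂ p)))
             ≡⟨ *-distribˡ-∑ (upTo (suc k)) (∑ (splits e) (fit p)) (λ i → 𝟙 (block? (k ∸ i) (proj₂ p))) ⟩
           ∑ (upTo (suc k)) (λ i → ∑ (splits e) (fit p) ℤ.* 𝟙 (block? (k ∸ i) (proj₂ p)))
             ≡⟨ ∑-cong (upTo (suc k)) (λ i _ →
                  *-distribʳ-∑ (splits e) (𝟙 (block? (k ∸ i) (proj₂ p))) (fit p)) ⟩
           ∑ (upTo (suc k)) (λ i → ∑ (splits e) (λ q → T p i q)) ∎) ⟩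
    ∑ (cuts u) (λ p → ∑ (upTo (suc k)) (λ i → ∑ (splits e) (λ q → T p i q)))
      ≡⟨ ∑-comm (cuts u) (upTo (suc k)) (λ p i → ∑ (splits e) (T p i)) ⟩
    ∑ (upTo (suc k)) (λ i → ∑ (cuts u) (λ p → ∑ (splits e) (λ q → T p i q)))
      -- For fixed `i` and `q` the sum over the cuts of `u` recombines the two conditions into one,
      -- for the exponent vector with first entry `k ∸ i`.
      ≡⟨ ∑-cong (upTo (suc k)) (λ i _ → trans (∑-comm (cuts u) (splits e) (λ p q → T p i q))
           (∑-cong (splits e) λ q _ → ∑-cuts-fits (k ∸ i) (proj₂ q) u)) ⟩
    ∑ (upTo (suc k)) (λ i → ∑ (splits e) (λ q → 𝟙 (fits? ((k ∸ i) ∷ proj₂ q) u)))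
      ≡⟨ ∑-cartesianProductWith (λ { i (a , b) → i ∷ a , (k ∸ i) ∷ b }) (upTo (suc k)) (splits e)
           (λ p → 𝟙 (fits? (proj₂ p) u)) ⟨
    ∑ (splits (k ∷ e)) (λ p → 𝟙 (fits? (proj₂ p) u)) ∎
    where
    s = Vec.sum e
    fit : List A × List A → Vec ℕ _ × Vec ℕ _ → ℤ
    fit p q = 𝟙 (fits? (proj₂ q) (proj₁ p))
    T : List A × List A → ℕ → Vec ℕ _ × Vec ℕ _ → ℤ
    T p i q = fit p q ℤ.* 𝟙 (block? (k ∸ i) (proj₂ p))

-- Decorated permutations

infixr 5 in∷_ out∷_

-- The k-element subsets of [n].
data Choice : ℕ → ℕ → Set where
  []    : Choice 0 0
  in∷_  : Choice n k → Choice (suc n) (suc k)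
  out∷_ : Choice n k → Choice (suc n) k

choices : ∀ n k → List (Choice n k)
choices zero    zero    = [] ∷ []
choices zero    (suc k) = []
choices (suc n) zero    = map out∷_ (choices n zero)
choices (suc n) (suc k) = map in∷_ (choices n k) ++ map out∷_ (choices n (suc k))

∈-choices : (T : Choice n k) → T ∈ choices n k
∈-choices []                  = here refl
∈-choices (in∷ T)             = ∈-++⁺ˡ (∈-map⁺ in∷_ (∈-choices T))
∈-choices {k = zero}  (out∷ T) = ∈-map⁺ out∷_ (∈-choices T)
∈-choices {k = suc k} (out∷ T) = ∈-++⁺ʳ (map in∷_ (choices _ k)) (∈-map⁺ out∷_ (∈-choices T))

choices-unique : ∀ n k → List.Unique (choices n k)
choices-unique zero    zero    = [] ∷ []
choices-unique zero    (suc k) = []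
choices-unique (suc n) zero    = Unique.map⁺ (λ where refl → refl) (choices-unique n zero)
choices-unique (suc n) (suc k) = Unique.++⁺
  (Unique.map⁺ (λ where refl → refl) (choices-unique n k))
  (Unique.map⁺ (λ where refl → refl) (choices-unique n (suc k)))
  disjoint
  where
  disjoint : ∀ {T} → ¬ (T ∈ map in∷_ (choices n k) × T ∈ map out∷_ (choices n (suc k)))
  disjoint (T∈ , T∈′) with ∈-map⁻ in∷_ T∈ | ∈-map⁻ out∷_ T∈′
  ... | _ , _ , refl | _ , _ , ()

Choice⇒≤ : Choice n k → k ℕ.≤ n
Choice⇒≤ []       = z≤n
Choice⇒≤ (in∷ T)  = s≤s (Choice⇒≤ T)
Choice⇒≤ (out∷ T) = ℕ.m≤n⇒m≤1+n (Choice⇒≤ T)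

embed : Choice n k → Fin k → Fin n
embed (in∷ T)  zero    = zero
embed (in∷ T)  (suc r) = suc (embed T r)
embed (out∷ T) r       = suc (embed T r)

embed-mono-< : (T : Choice n k) {r s : Fin k} → r Fin.< s → embed T r Fin.< embed T s
embed-mono-< (in∷ T)  {zero}  {suc s} _   = z<s
embed-mono-< (in∷ T)  {suc r} {suc s} r<s = s<s (embed-mono-< T (s<s⁻¹ r<s))
embed-mono-< (out∷ T) r<s                 = s<s (embed-mono-< T r<s)

embed-cancel-< : (T : Choice n k) {r s : Fin k} → embed T r Fin.< embed T s → r Fin.< s
embed-cancel-< (in∷ T)  {zero}  {suc s} _ = z<s
embed-cancel-< (in∷ T)  {suc r} {suc s} p = s<s (embed-cancel-< T (s<s⁻¹ p))
embed-cancel-< (out∷ T) p                 = embed-cancel-< T (s<s⁻¹ p)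

embed-injective : (T : Choice n k) {r s : Fin k} → embed T r ≡ embed T s → r ≡ s
embed-injective (in∷ T)  {zero}  {zero}  _  = refl
embed-injective (in∷ T)  {suc r} {suc s} eq = cong suc (embed-injective T (Fin.suc-injective eq))
embed-injective (out∷ T) eq                 = embed-injective T (Fin.suc-injective eq)

fill : A → Choice n k → Vec A k → Vec A n
fill z []       []      = []
fill z (in∷ T)  (x ∷ w) = x ∷ fill z T w
fill z (out∷ T) w       = z ∷ fill z T w

lookup-fill-embed : (z : A) (T : Choice n k) (w : Vec A k) (r : Fin k) →
  lookup (fill z T w) (embed T r) ≡ lookup w r
lookup-fill-embed z (in∷ T)  (x ∷ w) zero    = refl
lookup-fill-embed z (in∷ T)  (x ∷ w) (suc r) = lookup-fill-embed z T w r
lookup-fill-embed z (out∷ T) w       r       = lookup-fill-embed z T w r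

-- Phrased through `fill` for all fillers at once, because it is applied to words of indices, of
-- booleans and of barred letters.
Outside : Choice n k → Fin n → Set₁
Outside {k = k} T i = ∀ {A : Set} (z : A) (w : Vec A k) → lookup (fill z T w) i ≡ z

locate : (T : Choice n k) (i : Fin n) → (∃[ r ] i ≡ embed T r) ⊎ Outside T i
locate (in∷ T)  zero    = inj₁ (zero , refl)
locate (in∷ T)  (suc i) with locate T i
... | inj₁ (r , refl) = inj₁ (suc r , refl)
... | inj₂ out        = inj₂ λ where z (x ∷ w) → out z w
locate (out∷ T) zero    = inj₂ λ z w → refl
locate (out∷ T) (suc i) with locate T i
... | inj₁ (r , refl) = inj₁ (r , refl)
... | inj₂ out        = inj₂ out

fill-injective : (z : A) (T : Choice n k) {v w : Vec A k} → fill z T v ≡ fill z T w → v ≡ w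
fill-injective z []       {[]}    {[]}    _  = refl
fill-injective z (in∷ T)  {x ∷ v} {y ∷ w} eq =
  cong₂ _∷_ (Vec.∷-injectiveˡ eq) (fill-injective z T (Vec.∷-injectiveʳ eq))
fill-injective z (out∷ T) {v}     {w}     eq = fill-injective z T (Vec.∷-injectiveʳ eq)

-- As the words avoid `z`, the places of `z` in the filled word recover the choice. The sizes are
-- not known to agree beforehand, so the equality is one of pairs.
fill-injective-choice : (z : A) (T : Choice n k) (T′ : Choice n k′) (v : Vec A k) (v′ : Vec A k′) →
  (∀ r → lookup v r ≢ z) → (∀ r → lookup v′ r ≢ z) → fill z T v ≡ fill z T′ v′ →
  _≡_ {A = Σ ℕ (Choice n)} (k , T) (k′ , T′)
fill-injective-choice z [] [] v v′ _ _ _ = refl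
fill-injective-choice z (in∷ T) (in∷ T′) (x ∷ v) (x′ ∷ v′) v≢ v′≢ eq
  with fill-injective-choice z T T′ v v′ (v≢ ∘ suc) (v′≢ ∘ suc) (Vec.∷-injectiveʳ eq)
... | refl = refl
fill-injective-choice z (in∷ T) (out∷ T′) (x ∷ v) v′ v≢ _ eq = contradiction (Vec.∷-injectiveˡ eq) (v≢ zero)
fill-injective-choice z (out∷ T) (in∷ T′) v (x ∷ v′) _ v′≢ eq =
  contradiction (sym (Vec.∷-injectiveˡ eq)) (v′≢ zero)
fill-injective-choice z (out∷ T) (out∷ T′) v v′ v≢ v′≢ eq
  with fill-injective-choice z T T′ v v′ v≢ v′≢ (Vec.∷-injectiveʳ eq)
... | refl = refl

support : (w : Vec (Fin (suc m)) n) → ∃[ k ] Σ (Choice n k) λ T →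
  (∀ r → lookup w (embed T r) ≢ zero) × (∀ i → lookup w i ≢ zero → ∃[ r ] i ≡ embed T r)
support []      = 0 , [] , (λ ()) , λ ()
support (x ∷ w) with support w
support (zero ∷ w) | k , T , inside , cover = k , out∷ T , inside , cover′
  where
  cover′ : ∀ i → lookup (zero ∷ w) i ≢ zero → ∃[ r ] i ≡ embed (out∷ T) r
  cover′ zero    ≢0 = contradiction refl ≢0
  cover′ (suc i) ≢0 with cover i ≢0
  ... | r , refl = r , refl
support (suc x ∷ w) | k , T , inside , cover = suc k , in∷ T , inside′ , cover′
  where
  inside′ : ∀ r → lookup (suc x ∷ w) (embed (in∷ T) r) ≢ zero
  inside′ zero    ()
  inside′ (suc r) = inside r
  cover′ : ∀ i → lookup (suc x ∷ w) i ≢ zero → ∃[ r ] i ≡ embed (in∷ T) r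
  cover′ zero    _  = zero , refl
  cover′ (suc i) ≢0 with cover i ≢0
  ... | r , refl = suc r , refl

-- The increasing bijection from [k] to the chosen subset carries both the places and the values of
-- `π`; `suc` keeps the values apart from the blank `zero`.
decorate : Choice n k → Vec (Fin k) k → Vec (Fin (suc n)) n
decorate T π = fill zero T (Vec.map (suc ∘ embed T) π)

lookup-decorate-embed : (T : Choice n k) (π : Vec (Fin k) k) (r : Fin k) →
  lookup (decorate T π) (embed T r) ≡ suc (embed T (lookup π r))
lookup-decorate-embed T π r =
  trans (lookup-fill-embed zero T _ r) (Vec.lookup-map r (suc ∘ embed T) π)

lookup-decorate-≢ : (T : Choice n k) (π : Vec (Fin k) k) (i : Fin n) →
  lookup (decorate T π) i ≢ zero → ∃[ r ] i ≡ embed T r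
lookup-decorate-≢ T π i ≢0 with locate T i
... | inj₁ r   = r
... | inj₂ out = contradiction (out zero _) ≢0

decorate-injectiveˡ : (T : Choice n k) (T′ : Choice n k′) (π : Vec (Fin k) k) (π′ : Vec (Fin k′) k′) →
  decorate T π ≡ decorate T′ π′ → _≡_ {A = Σ ℕ (Choice n)} (k , T) (k′ , T′)
decorate-injectiveˡ T T′ π π′ = fill-injective-choice zero T T′ _ _ (nonzero T π) (nonzero T′ π′)
  where
  nonzero : ∀ {k} (T : Choice _ k) (π : Vec (Fin k) k) r → lookup (Vec.map (suc ∘ embed T) π) r ≢ zero
  nonzero T π r eq with trans (sym (Vec.lookup-map r (suc ∘ embed T) π)) eq
  ... | ()

decorate-injectiveʳ : (T : Choice n k) {π π′ : Vec (Fin k) k} → decorate T π ≡ decorate T π′ → π ≡ π′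
decorate-injectiveʳ T {π} {π′} eq = lookup-ext λ r → embed-injective T (Fin.suc-injective (begin
  suc (embed T (lookup π r))               ≡⟨ Vec.lookup-map r (suc ∘ embed T) π ⟨
  lookup (Vec.map (suc ∘ embed T) π) r     ≡⟨ cong (λ w → lookup w r) (fill-injective zero T eq) ⟩
  lookup (Vec.map (suc ∘ embed T) π′) r    ≡⟨ Vec.lookup-map r (suc ∘ embed T) π′ ⟩
  suc (embed T (lookup π′ r))              ∎))

-- Pigeonhole: if `s` were missed, removing it from the target would give an injection of `k + 1`
-- elements into `k`.
injective⇒surjective : (f : Fin k → Fin k) → (∀ {r s} → f r ≡ f s → r ≡ s) → ∀ s → ∃[ r ] f r ≡ s
injective⇒surjective {suc k} f inj s with Fin.any? (λ r → f r Fin.≟ s)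
... | yes r≡ = r≡
... | no ∄r  = contradiction (Fin.injective⇒≤ {f = λ r → Fin.punchOut (s≢ r)}
                 (λ eq → inj (Fin.punchOut-injective (s≢ _) (s≢ _) eq))) ℕ.1+n≰n
  where
  s≢ : ∀ r → s ≢ f r
  s≢ r eq = ∄r (r , sym eq)

decorate-isDecorated : (T : Choice n k) {π : Vec (Fin k) k} → Unique π → IsDecorated (decorate T π)
decorate-isDecorated {n} {k} T {π} π! = injective , into , onto
  where
  σ = decorate T π
  π-injective : ∀ {r s} → lookup π r ≡ lookup π s → r ≡ s
  π-injective = VecUnique.lookup-injective π! _ _
  injective : ∀ i j → lookup σ i ≢ zero → lookup σ i ≡ lookup σ j → i ≡ j
  injective i j ≢0 eq with lookup-decorate-≢ T π i ≢0 | lookup-decorate-≢ T π j (≢0 ∘ trans eq)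
  ... | r , refl | s , refl = cong (embed T) (π-injective (embed-injective T (Fin.suc-injective
    (trans (sym (lookup-decorate-embed T π r)) (trans eq (lookup-decorate-embed T π s))))))
  into : ∀ i j → lookup σ i ≡ suc j → lookup σ j ≢ zero
  into i j eq eq′ with lookup-decorate-≢ T π i (λ eq₀ → Fin.0≢1+n (trans (sym eq₀) eq))
  ... | r , refl with trans (sym (lookup-decorate-embed T π r)) eq
  ... | refl = Fin.0≢1+n (trans (sym eq′) (lookup-decorate-embed T π (lookup π r)))
  onto : ∀ j → lookup σ j ≢ zero → ∃[ i ] lookup σ i ≡ suc j
  onto j ≢0 with lookup-decorate-≢ T π j ≢0
  ... | s , refl with injective⇒surjective (lookup π) π-injective s
  ... | r , refl = embed T r , lookup-decorate-embed T π r

-- The positions of the nonzero letters form the subset. Each of these letters names a position that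
-- is again in the subset, so `σ` pulls back along `embed` to a self-map `p` of `Fin k`, injective
-- because `σ` is injective on the subset.
decorate-surjective : (σ : Vec (Fin (suc n)) n) → IsDecorated σ →
  ∃[ k ] Σ (Choice n k) λ T → Σ (Vec (Fin k) k) λ π → Unique π × decorate T π ≡ σ
decorate-surjective {n} σ (injective , into , _) with support σ
... | k , T , inside , cover = k , T , tabulate p , VecUnique.tabulate⁺ p-injective , lookup-ext agree
  where
  image : ∀ r → ∃[ s ] lookup σ (embed T r) ≡ suc (embed T s)
  image r with lookup σ (embed T r) in eq | inside r
  ... | zero  | ≢0 = contradiction refl ≢0
  ... | suc j | _ with cover j (into (embed T r) j eq)
  ... | s , refl = s , refl
  p : Fin k → Fin k
  p r = proj₁ (image r)
  p-injective : ∀ {r s} → p r ≡ p s → r ≡ s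
  p-injective {r} {s} eq = embed-injective T (injective _ _ (inside r)
    (trans (proj₂ (image r)) (trans (cong (suc ∘ embed T) eq) (sym (proj₂ (image s))))))
  agree : ∀ i → lookup (decorate T (tabulate p)) i ≡ lookup σ i
  agree i with locate T i | lookup σ i Fin.≟ zero
  ... | inj₁ (r , refl) | _ = begin
    lookup (decorate T (tabulate p)) (embed T r) ≡⟨ lookup-decorate-embed T (tabulate p) r ⟩
    suc (embed T (lookup (tabulate p) r))        ≡⟨ cong (suc ∘ embed T) (Vec.lookup∘tabulate p r) ⟩
    suc (embed T (p r))                          ≡⟨ proj₂ (image r) ⟨
    lookup σ (embed T r)                         ∎
  ... | inj₂ out | yes eq = trans (out zero _) (sym eq)
  ... | inj₂ out | no ≢0 with cover i ≢0
  ... | r , refl = contradiction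
    (trans (sym (lookup-decorate-embed T (tabulate p) r)) (out zero _)) λ ()

distinct? : (π : Vec (Fin k) k) → Dec (Unique π)
distinct? = allPairs? (λ u v → ¬? (u Fin.≟ v))

spread : ∀ n k → List (Vec (Fin (suc n)) n)
spread n k = cartesianProductWith (λ π T → decorate T π) (𝔖 k) (choices n k)

decorations : ∀ n → List (Vec (Fin (suc n)) n)
decorations n = concatMap (spread n) (upTo (suc n))

𝔖-unique : ∀ k → List.Unique (𝔖 k)
𝔖-unique k = Unique.filter⁺ distinct? (words-unique (Unique.allFin⁺ k) k)

-- The chosen subset, and with it its size, can be read off the word, so different sizes give
-- disjoint lists.
decorations-unique : ∀ n → List.Unique (decorations n)
decorations-unique n = Unique.concat⁺
  (All.map⁺ (All.universal
    (λ k → Unique.cartesianProductWith⁺ (λ π T → decorate T π)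
      (λ {π} {π′} {T} {T′} → injective {k} {π} {T} {π′} {T′}) (𝔖-unique k) (choices-unique n k))
    (upTo (suc n))))
  (AllPairs.map⁺ (AllPairs.map disjoint (Unique.upTo⁺ (suc n))))
  where
  injective : ∀ {k π T π′ T′} → decorate {n} {k} T π ≡ decorate T′ π′ → π ≡ π′ × T ≡ T′
  injective {T = T} {T′ = T′} eq with decorate-injectiveˡ T T′ _ _ eq
  ... | refl = decorate-injectiveʳ T eq , refl
  disjoint : ∀ {k k′} → k ≢ k′ → ∀ {σ} →
    ¬ (σ ∈ spread n k × σ ∈ spread n k′)
  disjoint {k} {k′} k≢k′ (σ∈ , σ∈′)
    with ∈-cartesianProductWith⁻ (λ π T → decorate T π) (𝔖 k) (choices n k) σ∈
       | ∈-cartesianProductWith⁻ (λ π T → decorate T π) (𝔖 k′) (choices n k′) σ∈′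
  ... | π , T , _ , _ , eq | π′ , T′ , _ , _ , eq′ =
    k≢k′ (cong proj₁ (decorate-injectiveˡ T T′ π π′ (trans (sym eq) eq′)))

𝔖̃↭decorations : ∀ n → 𝔖̃ n ↭ decorations n
𝔖̃↭decorations n = unique∧set⇒↭
  (Unique.filter⁺ isDecorated? (words-unique (Unique.allFin⁺ (suc n)) n)) (decorations-unique n)
  to from
  where
  to : ∀ {σ} → σ ∈ 𝔖̃ n → σ ∈ decorations n
  to {σ} σ∈ with decorate-surjective σ (proj₂ (∈-filter⁻ isDecorated? {xs = words (allFin (suc n)) n} σ∈))
  ... | k , T , π , π! , refl = ∈-concatMap⁺ _ (Any.map (λ { refl →
        ∈-cartesianProductWith⁺ (λ π T → decorate T π)
          (∈-filter⁺ distinct? (∈-words ∈-allFin π) π!) (∈-choices T) })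
      (∈-upTo⁺ (s≤s (Choice⇒≤ T))))
  from : ∀ {σ} → σ ∈ decorations n → σ ∈ 𝔖̃ n
  from σ∈ with Any.satisfied (∈-concatMap⁻ _ {xs = upTo (suc n)} σ∈)
  ... | k , σ∈′ with ∈-cartesianProductWith⁻ (λ π T → decorate T π) (𝔖 k) (choices n k) σ∈′
  ... | π , T , π∈ , _ , refl = ∈-filter⁺ isDecorated? (∈-words ∈-allFin _)
    (decorate-isDecorated T (proj₂ (∈-filter⁻ distinct? {xs = words (allFin k) k} π∈)))

-- Excedances and descents of decorated permutations

does-∈-tabulate : {P : Fin n → Set} (P? : ∀ j → Dec (P j)) (i : Fin n) →
  does (i ∈? tabulate (does ∘ P?)) ≡ does (P? i)
does-∈-tabulate P? i = does-⇔ (mk⇔ (∈-tabulateˢ⁻ P?) (∈-tabulateˢ⁺ P?)) (i ∈? _) (P? i)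

excedance? : (w : Vec ℕ n) (i : Fin n) → Dec (suc (toℕ i) ℕ.< lookup w i)
excedance? w i = suc (toℕ i) ℕ.<? lookup w i

letter : Bool → ℕ → Letter
letter b v = if b then inj₁ v else inj₂ v

lookup-bar : (w : Vec ℕ n) (i : Fin n) → lookup (bar w) i ≡ letter (does (excedance? w i)) (lookup w i)
lookup-bar w i = trans (Vec.lookup∘tabulate _ i)
  (cong (λ b → letter b (lookup w i)) (does-∈-tabulate (excedance? w) i))

lookup-oneLine : (π : Vec (Fin k) k) (r : Fin k) → lookup (oneLine π) r ≡ suc (toℕ (lookup π r))
lookup-oneLine π r = Vec.lookup-map r (suc ∘ toℕ) π

module _ (T : Choice n k) (π : Vec (Fin k) k) where

  private
    σ = Vec.map toℕ (decorate T π)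

  lookup-σ-embed : ∀ r → lookup σ (embed T r) ≡ suc (toℕ (embed T (lookup π r)))
  lookup-σ-embed r = trans
    (Vec.lookup-map (embed T r) toℕ (decorate T π)) (cong toℕ (lookup-decorate-embed T π r))

  lookup-σ-outside : ∀ {i} → Outside T i → lookup σ i ≡ 0
  lookup-σ-outside {i} out = trans (Vec.lookup-map i toℕ (decorate T π)) (cong toℕ (out zero _))

  -- `embed` preserves and reflects the order, and it acts on places and values alike.
  excedance-embed : ∀ r → does (excedance? σ (embed T r)) ≡ does (excedance? (oneLine π) r)
  excedance-embed r rewrite lookup-σ-embed r | lookup-oneLine π r = does-⇔
    (mk⇔ (s<s ∘ embed-cancel-< T ∘ s<s⁻¹) (s<s ∘ embed-mono-< T ∘ s<s⁻¹))
    (suc (toℕ (embed T r)) ℕ.<? suc (toℕ (embed T (lookup π r))))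
    (suc (toℕ r) ℕ.<? suc (toℕ (lookup π r)))

  excedance-outside : ∀ {i} → Outside T i → does (excedance? σ i) ≡ false
  excedance-outside {i} out = dec-false (excedance? σ i)
    λ lt → ℕ.n≮0 (subst (suc (toℕ i) ℕ.<_) (lookup-σ-outside out) lt)

  EXC-decorate : EXC σ ≡ fill false T (EXC (oneLine π))
  EXC-decorate = lookup-ext agree
    where
    agree : ∀ i → lookup (EXC σ) i ≡ lookup (fill false T (EXC (oneLine π))) i
    agree i with locate T i
    ... | inj₁ (r , refl) = begin
      lookup (EXC σ) (embed T r)
        ≡⟨ Vec.lookup∘tabulate (does ∘ excedance? σ) (embed T r) ⟩
      does (excedance? σ (embed T r))
        ≡⟨ excedance-embed r ⟩
      does (excedance? (oneLine π) r)
        ≡⟨ Vec.lookup∘tabulate (does ∘ excedance? (oneLine π)) r ⟨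
      lookup (EXC (oneLine π)) r
        ≡⟨ lookup-fill-embed false T (EXC (oneLine π)) r ⟨
      lookup (fill false T (EXC (oneLine π))) (embed T r) ∎
    ... | inj₂ out = trans (Vec.lookup∘tabulate (does ∘ excedance? σ) i)
      (trans (excedance-outside out) (sym (out false _)))

  exc-decorate : exc σ ≡ exc (oneLine π)
  exc-decorate = trans (cong Subset.∣_∣ EXC-decorate) (∣fill∣ T (EXC (oneLine π)))
    where
    ∣fill∣ : ∀ {n k} (T : Choice n k) (S : Subset k) → Subset.∣ fill false T S ∣ ≡ Subset.∣ S ∣
    ∣fill∣ []       []          = refl
    ∣fill∣ (in∷ T)  (true ∷ S)  = cong suc (∣fill∣ T S)
    ∣fill∣ (in∷ T)  (false ∷ S) = ∣fill∣ T S
    ∣fill∣ (out∷ T) S           = ∣fill∣ T S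

-- The decorated permutation has values in [n], the filled word has values in [k]. The two barred
-- words may differ; what agrees is the order of their letters, with 0 kept as the smallest number.
data Relabel (T : Choice n k) : ℕ → ℕ → Set where
  blank : Relabel T 0 0
  value : ∀ v → Relabel T (suc (toℕ (embed T v))) (suc (toℕ v))

relabel-< : (T : Choice n k) {a a′ b b′ : ℕ} → Relabel T a a′ → Relabel T b b′ → a ℕ.< b → a′ ℕ.< b′
relabel-< T blank     (value v) _   = z<s
relabel-< T (value u) (value v) u<v = s<s (embed-cancel-< T (s<s⁻¹ u<v))

relabel-> : (T : Choice n k) {a a′ b b′ : ℕ} → Relabel T a a′ → Relabel T b b′ → a′ ℕ.< b′ → a ℕ.< b
relabel-> T blank     (value v) _   = z<s
relabel-> T (value u) (value v) u<v = s<s (embed-mono-< T (s<s⁻¹ u<v))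

_≺_ : Rel Letter 0ℓ
_≺_ = ℕ._<_ ⊎-< ℕ._<_

relabel-≺ : (T : Choice n k) {a a′ b b′ : Letter} →
  Pointwise (Relabel T) (Relabel T) a a′ → Pointwise (Relabel T) (Relabel T) b b′ → a ≺ b ⇔ a′ ≺ b′
relabel-≺ {n} {k} T p q = mk⇔ (to p q) (from p q)
  where
  _~_ = Pointwise (Relabel T) (Relabel T)
  to : ∀ {a a′ b b′} → a ~ a′ → b ~ b′ → a ≺ b → a′ ≺ b′
  to (inj₁ p) (inj₁ q) (₁∼₁ lt) = ₁∼₁ (relabel-< T p q lt)
  to (inj₁ p) (inj₂ q) ₁∼₂      = ₁∼₂
  to (inj₂ p) (inj₂ q) (₂∼₂ lt) = ₂∼₂ (relabel-< T p q lt)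
  from : ∀ {a a′ b b′} → a ~ a′ → b ~ b′ → a′ ≺ b′ → a ≺ b
  from (inj₁ p) (inj₁ q) (₁∼₁ lt) = ₁∼₁ (relabel-> T p q lt)
  from (inj₁ p) (inj₂ q) ₁∼₂      = ₁∼₂
  from (inj₂ p) (inj₂ q) (₂∼₂ lt) = ₂∼₂ (relabel-> T p q lt)

relabel-letter : (T : Choice n k) (b : Bool) {v v′ : ℕ} → Relabel T v v′ →
  Pointwise (Relabel T) (Relabel T) (letter b v) (letter b v′)
relabel-letter T true  p = inj₁ p
relabel-letter T false p = inj₂ p

𝟎 : Letter
𝟎 = inj₂ 0

bar-decorate : (T : Choice n k) (π : Vec (Fin k) k) (i : Fin n) →
  Pointwise (Relabel T) (Relabel T)
    (lookup (bar (Vec.map toℕ (decorate T π))) i) (lookup (fill 𝟎 T (bar (oneLine π))) i)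
bar-decorate T π i rewrite lookup-bar (Vec.map toℕ (decorate T π)) i with locate T i
... | inj₂ out
  rewrite out 𝟎 (bar (oneLine π)) | excedance-outside T π out | lookup-σ-outside T π out
  = inj₂ blank
... | inj₁ (r , refl)
  rewrite lookup-fill-embed 𝟎 T (bar (oneLine π)) r | lookup-bar (oneLine π) r
        | excedance-embed T π r | lookup-σ-embed T π r | lookup-oneLine π r
  = relabel-letter T _ (value (lookup π r))

DES-cong : {w w′ : Vec Letter n} →
  (∀ i j → lookup w i ≺ lookup w j ⇔ lookup w′ i ≺ lookup w′ j) → DES _≺?_ w ≡ DES _≺?_ w′
DES-cong {zero}  _  = refl
DES-cong {suc n} {w} {w′} eq = Vec.tabulate-cong λ j →
  does-⇔ (eq (suc j) (inject₁ j)) (lookup w (suc j) ≺? lookup w (inject₁ j))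
    (lookup w′ (suc j) ≺? lookup w′ (inject₁ j))

DEX-decorate : (T : Choice n k) (π : Vec (Fin k) k) →
  DEX (Vec.map toℕ (decorate T π)) ≡ DES _≺?_ (fill 𝟎 T (bar (oneLine π)))
DEX-decorate T π = DES-cong λ i j → relabel-≺ T (bar-decorate T π i) (bar-decorate T π j)

-- Products of complete homogeneous and fundamental quasisymmetric functions

∑ˢ-coefficient : (xs : List A) (f : A → Series) (e : Vec ℕ m) → ∑ˢ xs f m e ≡ ∑ xs (λ x → f x m e)
∑ˢ-coefficient []       f e = refl
∑ˢ-coefficient (x ∷ xs) f e = cong (ℤ._+_ (f x _ e)) (∑ˢ-coefficient xs f e)

-- Read from left to right, a choice decides at each place between the next letter of `u` and `z`,
-- just as the recursion of `shuffle∑` does.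
∑-choices : (z : A) (n : ℕ) (u : Vec A k) (f : List A → ℤ) →
  ∑ (choices n k) (λ T → f (toList (fill z T u))) ≡ shuffle∑ z n (toList u) f
∑-choices z zero    []      f = ℤ.+-identityʳ (f [])
∑-choices z zero    (x ∷ u) f = refl
∑-choices z (suc n) []      f = trans (∑-map out∷_ (choices n 0) (λ T → f (toList (fill z T []))))
  (∑-choices z n [] (f ∘ (z ∷_)))
∑-choices {k = suc k} z (suc n) (x ∷ u) f = begin
  ∑ (map in∷_ (choices n k) ++ map out∷_ (choices n (suc k))) g
    ≡⟨ ∑-++ (map in∷_ (choices n k)) _ g ⟩
  ∑ (map in∷_ (choices n k)) g ℤ.+ ∑ (map out∷_ (choices n (suc k))) g
    ≡⟨ cong₂ ℤ._+_ (∑-map in∷_ (choices n k) g) (∑-map out∷_ (choices n (suc k)) g) ⟩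
  ∑ (choices n k) (λ T → f (x ∷ toList (fill z T u)))
    ℤ.+ ∑ (choices n (suc k)) (λ T → f (z ∷ toList (fill z T (x ∷ u))))
    ≡⟨ cong₂ ℤ._+_ (∑-choices z n u (f ∘ (x ∷_))) (∑-choices z n (x ∷ u) (f ∘ (z ∷_))) ⟩
  shuffle∑ z (suc n) (x ∷ toList u) f ∎
  where
  g : Choice (suc n) (suc k) → ℤ
  g T = f (toList (fill z T (x ∷ u)))

splits-sum : (e : Vec ℕ m) → ∀ p → p ∈ splits e → Vec.sum (proj₁ p) ℕ.+ Vec.sum (proj₂ p) ≡ Vec.sum e
splits-sum []      p (here refl) = refl
splits-sum (k ∷ e) p p∈
  with ∈-cartesianProductWith⁻ (λ { i (a , b) → i ∷ a , (k ∸ i) ∷ b }) (upTo (suc k)) (splits e) p∈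
... | i , (a , b) , i∈ , q∈ , refl = begin
  (i ℕ.+ Vec.sum a) ℕ.+ (k ∸ i ℕ.+ Vec.sum b)
    ≡⟨ +ℕ.interchange i (Vec.sum a) (k ∸ i) (Vec.sum b) ⟩
  (i ℕ.+ (k ∸ i)) ℕ.+ (Vec.sum a ℕ.+ Vec.sum b)
    ≡⟨ cong₂ ℕ._+_ (ℕ.m+[n∸m]≡n (ℕ.s≤s⁻¹ (∈-upTo⁻ i∈))) (splits-sum e (a , b) q∈) ⟩
  k ℕ.+ Vec.sum e ∎

module _ {A : Set} {_≈_ _≺_ : Rel A 0ℓ}
         (isSTO : IsStrictTotalOrder _≈_ _≺_) (_≺?_ : Decidable _≺_) (z : A) where

  open Fitting isSTO _≺?_
  open Shuffling isSTO _≺?_ z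

  -- `shuffle∑-fits` accounts for the products with every h at once; here the degree of `e` picks
  -- out a single one.
  h-*ˢ-F : k ℕ.≤ n → (w : Vec A k) → All Separated (toList w) →
    h (n ∸ k) *ˢ F k (DES _≺?_ w) ≈ˢ ∑ˢ (choices n k) (λ T → F n (DES _≺?_ (fill z T w)))
  h-*ˢ-F {k} {n} k≤n w sep m e = begin
    ∑ (splits e) (λ { (a , b) → h (n ∸ k) m a ℤ.* F k (DES _≺?_ w) m b })
      ≡⟨ ∑-cong (splits e) (λ p _ → cong (ℤ._*_ (h (n ∸ k) m (proj₁ p))) (F-coefficient w (proj₂ p))) ⟩
    ∑ (splits e) (λ p → 𝟙 (Vec.sum (proj₁ p) ℕ.≟ n ∸ k) ℤ.* 𝟙 (fits? (proj₂ p) u))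
      ≡⟨ degree ⟩
    shuffle∑ z n u (𝟙 ∘ fits? e)
      ≡⟨ ∑-choices z n w (𝟙 ∘ fits? e) ⟨
    ∑ (choices n k) (λ T → 𝟙 (fits? e (toList (fill z T w))))
      ≡⟨ ∑-cong (choices n k) (λ T _ → F-coefficient (fill z T w) e) ⟨
    ∑ (choices n k) (λ T → F n (DES _≺?_ (fill z T w)) m e)
      ≡⟨ ∑ˢ-coefficient (choices n k) (λ T → F n (DES _≺?_ (fill z T w))) e ⟨
    ∑ˢ (choices n k) (λ T → F n (DES _≺?_ (fill z T w))) m e ∎
    where
    u = toList w
    fits-sum : (b : Vec ℕ m) → Fits b u → Vec.sum b ≡ k
    fits-sum b (len , _) = trans (sym (length-idx b)) (trans len (Vec.length-toList w))
    degree : ∑ (splits e) (λ p → 𝟙 (Vec.sum (proj₁ p) ℕ.≟ n ∸ k) ℤ.* 𝟙 (fits? (proj₂ p) u)) ≡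
      shuffle∑ z n u (𝟙 ∘ fits? e)
    -- If `e` has degree `n`, a second part that fits `u` has degree `k`, which forces degree
    -- `n ∸ k` on the first part. Otherwise both sides vanish, since all their terms have degree
    -- `n`.
    degree with Vec.sum e ℕ.≟ n
    ... | yes refl = trans (∑-cong (splits e) λ p p∈ →
            trans (sym (𝟙-× (Vec.sum (proj₁ p) ℕ.≟ n ∸ k) (fits? (proj₂ p) u)))
                  (𝟙-⇔ ((Vec.sum (proj₁ p) ℕ.≟ n ∸ k) ×-dec fits? (proj₂ p) u) (fits? (proj₂ p) u) proj₂ λ fits →
                    (begin
                      Vec.sum (proj₁ p)
                        ≡⟨ ℕ.m+n∸n≡m (Vec.sum (proj₁ p)) (Vec.sum (proj₂ p)) ⟨
                      Vec.sum (proj₁ p) ℕ.+ Vec.sum (proj₂ p) ∸ Vec.sum (proj₂ p)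
                        ≡⟨ cong₂ _∸_ (splits-sum e p p∈) (fits-sum (proj₂ p) fits) ⟩
                      n ∸ k ∎) , fits))
            (sym (shuffle∑-fits e sep))
    ... | no ≢n = trans (trans (∑-cong (splits e) λ p p∈ →
            trans (sym (𝟙-× (Vec.sum (proj₁ p) ℕ.≟ n ∸ k) (fits? (proj₂ p) u)))
                  (𝟙-no ((Vec.sum (proj₁ p) ℕ.≟ n ∸ k) ×-dec fits? (proj₂ p) u) λ (eq , fits) →
                    ≢n (begin
                      Vec.sum e ≡⟨ splits-sum e p p∈ ⟨
                      Vec.sum (proj₁ p) ℕ.+ Vec.sum (proj₂ p) ≡⟨ cong₂ ℕ._+_ eq (fits-sum (proj₂ p) fits) ⟩
                      -- The bound `k≤n` makes the truncated subtraction exact.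
                      n ∸ k ℕ.+ k ≡⟨ ℕ.m∸n+n≡m k≤n ⟩
                      n ∎)))
            (∑-0 (splits e)))
          (sym (shuffle∑-zero n u λ v len → 𝟙-no (fits? e v) λ (leq , _) →
            ≢n (trans (sym (length-idx e)) (trans leq len))))

  -- A constant word has no descent, so every exponent vector of degree `n` fits it. This will be
  -- the contribution of `θ`, the shuffle of the empty word with zeros.
  h≈F-DES-replicate : ∀ n → h n ≈ˢ F n (DES _≺?_ (Vec.replicate n z))
  h≈F-DES-replicate n m e = trans (𝟙-⇔ (Vec.sum e ℕ.≟ n) (fits? e (toList w)) to from)
                                  (sym (F-coefficient w e))
    where
    w = Vec.replicate n z
    constant : ∀ {m} (is : List (Fin m)) → Decreasing is → AllPairs R (zip is (replicate (length is) z))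
    constant []       []         = []
    constant (i ∷ is) (i≥ ∷ is↘) = first is i≥ ∷ constant is is↘
      where
      first : ∀ is → All (Fin._≤ i) is → All (R (i , z)) (zip is (replicate (length is) z))
      first []       []         = []
      first (j ∷ is) (j≤i ∷ is≤) = (j≤i , λ z≺z → contradiction z≺z ≼-refl) ∷ first is is≤
    toList-replicate : ∀ n → toList (Vec.replicate n z) ≡ replicate n z
    toList-replicate zero    = refl
    toList-replicate (suc n) = cong (z ∷_) (toList-replicate n)
    len : length (toList w) ≡ n
    len = Vec.length-toList w
    to : Vec.sum e ≡ n → Fits e (toList w)
    to refl = trans (length-idx e) (sym len) ,
      subst (AllPairs R ∘ zip (idx e)) 
        (sym (trans (toList-replicate n) (cong (λ l → replicate l z) (sym (length-idx e)))))
        (constant (idx e) (idx-decreasing e))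
    from : Fits e (toList w) → Vec.sum e ≡ n
    from (leq , _) = trans (sym (length-idx e)) (trans leq len)

-- Eulerian quasisymmetric functions

if-cong : (b : Bool) {x y : A} {z : A} → x ≡ y → (if b then x else z) ≡ (if b then y else z)
if-cong true  eq = eq
if-cong false eq = refl

∑-if : (b : Bool) (xs : List A) (f : A → ℤ) →
  (if b then ∑ xs f else 0ℤ) ≡ ∑ xs (λ x → if b then f x else 0ℤ)
∑-if true  xs f = refl
∑-if false xs f = sym (∑-0 xs)

∑ᵗ-coefficient : (xs : List A) (P : A → Poly) (j : ℕ) (e : Vec ℕ m) → ∑ᵗ xs P j m e ≡ ∑ xs (λ x → P x j m e)
∑ᵗ-coefficient []       P j e = refl
∑ᵗ-coefficient (x ∷ xs) P j e = cong (ℤ._+_ (P x j _ e)) (∑ᵗ-coefficient xs P j e)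

t^-coefficient : (f : Series) (i j : ℕ) (e : Vec ℕ m) →
  (f t^ i) j m e ≡ (if does (j ℕ.≟ i) then f m e else 0ℤ)
t^-coefficient f i j e with does (j ℕ.≟ i)
... | true  = refl
... | false = refl

*ˢ-distribˡ-∑ᵗ : (f : Series) (xs : List A) (P : A → Poly) (j : ℕ) (e : Vec ℕ m) →
  (f *ˢ ∑ᵗ xs P j) m e ≡ ∑ xs (λ x → (f *ˢ P x j) m e)
*ˢ-distribˡ-∑ᵗ {m = m} f xs P j e = begin
  ∑ (splits e) (λ p → f m (proj₁ p) ℤ.* ∑ᵗ xs P j m (proj₂ p))
    ≡⟨ ∑-cong (splits e) (λ p _ → trans (cong (ℤ._*_ (f m (proj₁ p))) (∑ᵗ-coefficient xs P j (proj₂ p)))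
         (*-distribˡ-∑ xs (f m (proj₁ p)) (λ x → P x j m (proj₂ p)))) ⟩
  ∑ (splits e) (λ p → ∑ xs (λ x → f m (proj₁ p) ℤ.* P x j m (proj₂ p)))
    ≡⟨ ∑-comm (splits e) xs (λ p x → f m (proj₁ p) ℤ.* P x j m (proj₂ p)) ⟩
  ∑ xs (λ x → (f *ˢ P x j) m e) ∎

*ˢ-t^ : (f g : Series) (i j : ℕ) (e : Vec ℕ m) →
  (f *ˢ (g t^ i) j) m e ≡ (if does (j ℕ.≟ i) then (f *ˢ g) m e else 0ℤ)
*ˢ-t^ f g i j e with does (j ℕ.≟ i)
... | true  = refl
... | false = ∑-zero (splits e) λ p → ℤ.*-zeroʳ (f _ (proj₁ p))

≺-isStrictTotalOrder : IsStrictTotalOrder (Pointwise _≡_ _≡_) _≺_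
≺-isStrictTotalOrder = ⊎-<-isStrictTotalOrder ℕ.<-isStrictTotalOrder ℕ.<-isStrictTotalOrder

open Fitting ≺-isStrictTotalOrder _≺?_ using (descent?)
open Shuffling ≺-isStrictTotalOrder _≺?_ 𝟎 using (Separated)

All-toList : {P : A → Set} (w : Vec A n) → (∀ i → P (lookup w i)) → All P (toList w)
All-toList []      p = []
All-toList (x ∷ w) p = p zero ∷ All-toList w (p ∘ suc)

-- Barred letters lie below the unbarred 0; the unbarred letters of a permutation are positive and
-- lie above it.
bar-separated : (π : Vec (Fin k) k) → All Separated (toList (bar (oneLine π)))
bar-separated π = All-toList (bar (oneLine π)) separated
  where
  separated : ∀ r → Separated (lookup (bar (oneLine π)) r)
  separated r rewrite lookup-bar (oneLine π) r | lookup-oneLine π r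
    with does (suc (toℕ r) ℕ.<? suc (toℕ (lookup π r)))
  ... | true  = inj₁ ₁∼₂
  ... | false = inj₂ (₂∼₂ z<s)

decorate-≢θ : (T : Choice n (suc k)) (π : Vec (Fin (suc k)) (suc k)) → decorate T π ≢ θ
decorate-≢θ {n} T π eq = Fin.0≢1+n (begin
  zero                                 ≡⟨ Vec.lookup-replicate (embed T zero) zero ⟨
  lookup (θ {n}) (embed T zero)        ≡⟨ cong (λ w → lookup w (embed T zero)) eq ⟨
  lookup (decorate T π) (embed T zero) ≡⟨ lookup-decorate-embed T π zero ⟩
  suc (embed T (lookup π zero))        ∎)

exc~-decorate : (T : Choice n (suc k)) (π : Vec (Fin (suc k)) (suc k)) →
  exc~ (decorate T π) ≡ + exc (oneLine π)
exc~-decorate T π rewrite dec-false (isθ? (decorate T π)) (decorate-≢θ T π) = cong +_ (exc-decorate T π)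

DEX~-decorate : (T : Choice n (suc k)) (π : Vec (Fin (suc k)) (suc k)) →
  DEX~ (decorate T π) ≡ DES _≺?_ (fill 𝟎 T (bar (oneLine π)))
DEX~-decorate T π rewrite dec-false (isθ? (decorate T π)) (decorate-≢θ T π) = DEX-decorate T π

exc~-θ : exc~ (θ {n}) ≡ -1ℤ
exc~-θ {n} rewrite dec-true (isθ? (θ {n})) refl = refl

-- The conventional empty set is also the descent set of a constant word, so `θ` follows the same
-- pattern as the other decorated permutations.
DEX~-θ : DEX~ (θ {n}) ≡ DES _≺?_ (Vec.replicate n 𝟎)
DEX~-θ {n} rewrite dec-true (isθ? (θ {n})) refl = ⊥≡ n
  where
  ⊥≡ : ∀ n → Subset.⊥ ≡ DES _≺?_ (Vec.replicate n 𝟎)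
  ⊥≡ zero    = refl
  ⊥≡ (suc n) = lookup-ext λ j → trans (Vec.lookup-replicate j false) (sym (trans
    (Vec.lookup∘tabulate (does ∘ descent? (Vec.replicate (suc n) 𝟎)) j)
    (cong₂ (λ a b → does (a ≺? b)) (Vec.lookup-replicate (suc j) 𝟎) (Vec.lookup-replicate (inject₁ j) 𝟎))))

-- Coefficients of the expansion over decorated permutations

module _ (n : ℕ) (e : Vec ℕ m) where

  term : ℕ → Vec (Fin (suc n)) n → ℤ
  term j σ = (F n (DEX~ σ) t^ ∣ exc~ σ ℤ.+ 1ℤ ∣) j m e

  term-θ : ∀ j → term j θ ≡ (h n t^ 0) j m e
  term-θ j rewrite exc~-θ {n} | DEX~-θ {n} = begin
    (F n (DES _≺?_ (Vec.replicate n 𝟎)) t^ 0) j m e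
      ≡⟨ t^-coefficient (F n (DES _≺?_ (Vec.replicate n 𝟎))) 0 j e ⟩
    (if does (j ℕ.≟ 0) then F n (DES _≺?_ (Vec.replicate n 𝟎)) m e else 0ℤ)
      ≡⟨ if-cong (does (j ℕ.≟ 0)) (sym (h≈F-DES-replicate ≺-isStrictTotalOrder _≺?_ 𝟎 n m e)) ⟩
    (if does (j ℕ.≟ 0) then h n m e else 0ℤ)
      ≡⟨ t^-coefficient (h n) 0 j e ⟨
    (h n t^ 0) j m e ∎

  term-decorate : ∀ j (T : Choice n (suc k)) (π : Vec (Fin (suc k)) (suc k)) →
    term j (decorate T π) ≡ (F n (DES _≺?_ (fill 𝟎 T (bar (oneLine π)))) t^ suc (exc (oneLine π))) j m e
  term-decorate j T π rewrite exc~-decorate T π | DEX~-decorate T π | ℕ.+-comm (exc (oneLine π)) 1 = refl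

  ∑-term-suc : ∀ j → suc k ≤ n →
    ∑ (𝔖 (suc k)) (λ π → ∑ (choices n (suc k)) (λ T → term j (decorate T π))) ≡
    (t· (h (n ∸ suc k) ·ᵗ Q (suc k))) j m e
  -- All exponents of t are successors here, so the coefficient of t^0 is zero on both sides.
  ∑-term-suc {k} zero    k<n = ∑-zero (𝔖 (suc k)) λ π → ∑-zero (choices n (suc k)) λ T → term-decorate 0 T π
  ∑-term-suc {k} (suc j) k<n = begin
    ∑ (𝔖 (suc k)) (λ π → ∑ (choices n (suc k)) (λ T → term (suc j) (decorate T π)))
      ≡⟨ ∑-cong (𝔖 (suc k)) (λ π _ → product π) ⟩
    ∑ (𝔖 (suc k)) (λ π → (h (n ∸ suc k) *ˢ (F (suc k) (DEX (oneLine π)) t^ exc (oneLine π)) j) m e)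
      ≡⟨ *ˢ-distribˡ-∑ᵗ (h (n ∸ suc k)) (𝔖 (suc k))
           (λ π → F (suc k) (DEX (oneLine π)) t^ exc (oneLine π)) j e ⟨
    (h (n ∸ suc k) *ˢ Q (suc k) j) m e ∎
    where
    product : ∀ π → ∑ (choices n (suc k)) (λ T → term (suc j) (decorate T π)) ≡
      (h (n ∸ suc k) *ˢ (F (suc k) (DEX (oneLine π)) t^ exc (oneLine π)) j) m e
    product π = begin
      ∑ (choices n (suc k)) (λ T → term (suc j) (decorate T π))
        ≡⟨ ∑-cong (choices n (suc k)) (λ T _ → trans (term-decorate (suc j) T π)
             (t^-coefficient (G T) (suc (exc (oneLine π))) (suc j) e)) ⟩
      ∑ (choices n (suc k)) (λ T → if b then G T m e else 0ℤ)
        ≡⟨ ∑-if b (choices n (suc k)) (λ T → G T m e) ⟨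
      (if b then ∑ (choices n (suc k)) (λ T → G T m e) else 0ℤ)
        ≡⟨ if-cong b (trans (sym (∑ˢ-coefficient (choices n (suc k)) G e))
             (sym (h-*ˢ-F ≺-isStrictTotalOrder _≺?_ 𝟎 k<n (bar (oneLine π)) (bar-separated π) m e))) ⟩
      (if b then (h (n ∸ suc k) *ˢ F (suc k) (DEX (oneLine π))) m e else 0ℤ)
        ≡⟨ *ˢ-t^ (h (n ∸ suc k)) (F (suc k) (DEX (oneLine π))) (exc (oneLine π)) j e ⟨
      (h (n ∸ suc k) *ˢ (F (suc k) (DEX (oneLine π)) t^ exc (oneLine π)) j) m e ∎
      where
      G : Choice n (suc k) → Series
      G T = F n (DES _≺?_ (fill 𝟎 T (bar (oneLine π))))
      b = does (j ℕ.≟ exc (oneLine π))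

∑-choices-zero : ∀ n (f : Vec (Fin (suc n)) n → ℤ) → ∑ (choices n 0) (λ T → f (decorate T [])) ≡ f θ
∑-choices-zero n f = trans (∑-cong (choices n 0) λ T _ → cong f (decorate-[] T)) (once n)
  where
  decorate-[] : (T : Choice n 0) → decorate T [] ≡ θ
  decorate-[] T = fill-[] T
    where
    fill-[] : ∀ {n} {z : Fin m} (T : Choice n 0) → fill z T [] ≡ Vec.replicate n z
    fill-[] []       = refl
    fill-[] (out∷ T) = cong (_ ∷_) (fill-[] T)
  once : ∀ n {c} → ∑ (choices n 0) (λ _ → c) ≡ c
  once zero    = ℤ.+-identityʳ _
  once (suc n) = trans (∑-map out∷_ (choices n 0) _) (once n)

-- Decorated permutations are grouped by the size k of their support. Size 0 is `θ` alone, with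
-- exponent -1 + 1, and gives the summand h; each size from 1 to n gives one summand of the sum
-- multiplied by t.
Q̃-expansion : ∀ n → Q̃ n ≈ᵗ ∑ᵗ (𝔖̃ n) (λ σ → F n (DEX~ σ) t^ ∣ exc~ σ ℤ.+ 1ℤ ∣)
Q̃-expansion n j m e = sym (begin
  ∑ᵗ (𝔖̃ n) (λ σ → F n (DEX~ σ) t^ ∣ exc~ σ ℤ.+ 1ℤ ∣) j m e
    ≡⟨ ∑ᵗ-coefficient (𝔖̃ n) (λ σ → F n (DEX~ σ) t^ ∣ exc~ σ ℤ.+ 1ℤ ∣) j e ⟩
  ∑ (𝔖̃ n) (term n e j)
    ≡⟨ ∑-↭ (term n e j) (𝔖̃↭decorations n) ⟩
  ∑ (decorations n) (term n e j)
    ≡⟨ ∑-concatMap (spread n) (upTo (suc n)) (term n e j) ⟩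
  ∑ (upTo (suc n)) (λ k → ∑ (spread n k) (term n e j))
    ≡⟨ ∑-cong (upTo (suc n)) (λ k _ →
         ∑-cartesianProductWith (λ π T → decorate T π) (𝔖 k) (choices n k) (term n e j)) ⟩
  ∑ (upTo (suc n)) S
    ≡⟨ ∑-upTo-suc n S ⟩
  S 0 ℤ.+ ∑ (upTo n) (S ∘ suc)
    ≡⟨ cong₂ ℤ._+_ (trans (ℤ.+-identityʳ _) (trans (∑-choices-zero n (term n e j)) (term-θ n e j)))
         (∑-cong (upTo n) λ k k∈ → ∑-term-suc n e j (∈-upTo⁻ k∈)) ⟩
  (h n t^ 0) j m e ℤ.+ ∑ (upTo n) (λ k → (t· (h (n ∸ suc k) ·ᵗ Q (suc k))) j m e)
    ≡⟨ cong (ℤ._+_ ((h n t^ 0) j m e)) (shift j) ⟩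
  Q̃ n j m e ∎)
  where
  S : ℕ → ℤ
  S k = ∑ (𝔖 k) (λ π → ∑ (choices n k) (λ T → term n e j (decorate T π)))
  P : ℕ → Poly
  P k = h (n ∸ k) ·ᵗ Q k
  shift : ∀ j → ∑ (upTo n) (λ k → (t· P (suc k)) j m e) ≡ (t· ∑ᵗ (map suc (upTo n)) P) j m e
  shift zero    = ∑-0 (upTo n)
  shift (suc j) = trans (sym (∑-map suc (upTo n) (λ k → P k j m e)))
    (sym (∑ᵗ-coefficient (map suc (upTo n)) P j e))

-- The least possible value of `exc~` is -1, so the absolute value in the exponent of t loses
-- nothing.
exc~+1-nonneg : (σ : Vec (Fin (suc n)) n) → exc~ σ ℤ.+ 1ℤ ≡ + ∣ exc~ σ ℤ.+ 1ℤ ∣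
exc~+1-nonneg σ with does (isθ? σ)
... | true  = refl
... | false = refl

∣exc~+1∣-⇔ : (σ : Vec (Fin (suc n)) n) (j : ℕ) → j ≡ ∣ exc~ σ ℤ.+ 1ℤ ∣ ⇔ exc~ σ ≡ + j ℤ.- 1ℤ
∣exc~+1∣-⇔ σ j = mk⇔ to from
  where
  to : j ≡ ∣ exc~ σ ℤ.+ 1ℤ ∣ → exc~ σ ≡ + j ℤ.- 1ℤ
  to eq = begin
    exc~ σ                      ≡⟨ ℤ.+-identityʳ (exc~ σ) ⟨
    exc~ σ ℤ.+ (1ℤ ℤ.- 1ℤ)      ≡⟨ ℤ.+-assoc (exc~ σ) 1ℤ -1ℤ ⟨
    (exc~ σ ℤ.+ 1ℤ) ℤ.- 1ℤ      ≡⟨ cong (ℤ._- 1ℤ) (trans (exc~+1-nonneg σ) (cong +_ (sym eq))) ⟩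
    + j ℤ.- 1ℤ                  ∎
  from : exc~ σ ≡ + j ℤ.- 1ℤ → j ≡ ∣ exc~ σ ℤ.+ 1ℤ ∣
  from eq = sym (cong ∣_∣ (begin
    exc~ σ ℤ.+ 1ℤ               ≡⟨ cong (ℤ._+ 1ℤ) eq ⟩
    (+ j ℤ.- 1ℤ) ℤ.+ 1ℤ         ≡⟨ ℤ.+-assoc (+ j) -1ℤ 1ℤ ⟩
    + j ℤ.+ 0ℤ                  ≡⟨ ℤ.+-identityʳ (+ j) ⟩
    + j                         ∎))

theorem6p21 : (n : ℕ) →
    (Q̃ n ≈ᵗ ∑ᵗ (𝔖̃ n) (λ σ → F n (DEX~ σ) t^ ∣ exc~ σ ℤ.+ 1ℤ ∣))
    × (∀ j → j ≤ n →
    Q̃ n j ≈ˢ ∑ˢ (filter (λ σ → exc~ σ ≟ (+ j ℤ.- 1ℤ)) (𝔖̃ n)) (λ σ → F n (DEX~ σ)))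
theorem6p21 n = Q̃-expansion n , λ j _ m e → begin
  Q̃ n j m e
    ≡⟨ Q̃-expansion n j m e ⟩
  ∑ᵗ (𝔖̃ n) (λ σ → F n (DEX~ σ) t^ ∣ exc~ σ ℤ.+ 1ℤ ∣) j m e
    ≡⟨ ∑ᵗ-coefficient (𝔖̃ n) (λ σ → F n (DEX~ σ) t^ ∣ exc~ σ ℤ.+ 1ℤ ∣) j e ⟩
  ∑ (𝔖̃ n) (term n e j)
    ≡⟨ ∑-cong (𝔖̃ n) (λ σ _ → trans (t^-coefficient (F n (DEX~ σ)) ∣ exc~ σ ℤ.+ 1ℤ ∣ j e)
         (cong (λ b → if b then F n (DEX~ σ) m e else 0ℤ)
           (does-⇔ (∣exc~+1∣-⇔ σ j) (j ℕ.≟ ∣ exc~ σ ℤ.+ 1ℤ ∣) (exc~ σ ≟ (+ j ℤ.- 1ℤ))))) ⟩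
  ∑ (𝔖̃ n) (λ σ → if does (exc~ σ ≟ (+ j ℤ.- 1ℤ)) then F n (DEX~ σ) m e else 0ℤ)
    ≡⟨ ∑-filter (λ σ → exc~ σ ≟ (+ j ℤ.- 1ℤ)) (𝔖̃ n) (λ σ → F n (DEX~ σ) m e) ⟨
  ∑ (filter (λ σ → exc~ σ ≟ (+ j ℤ.- 1ℤ)) (𝔖̃ n)) (λ σ → F n (DEX~ σ) m e)
    ≡⟨ ∑ˢ-coefficient (filter (λ σ → exc~ σ ≟ (+ j ℤ.- 1ℤ)) (𝔖̃ n)) (λ σ → F n (DEX~ σ)) e ⟨
  ∑ˢ (filter (λ σ → exc~ σ ≟ (+ j ℤ.- 1ℤ)) (𝔖̃ n)) (λ σ → F n (DEX~ σ)) m e ∎
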